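{- Let $G$ and $H$ be finite simple graphs with $\alpha(G)\le 2$ and $\alpha(H)\le 2$, and suppose $|V(H)|\le 4$. If $G$ is $H$-free, then $G$ contains the complete graph $K_{\lceil n/2\rceil}$ as an immersion, where $n=|V(G)|$.
   Context: $\alpha(\cdot)$ denotes the independence number. $G$ is $H$-free if $G$ has no induced subgraph isomorphic to $H$. A graph $G$ contains a graph $K$ as an immersion if there is an injective map $\phi\colon V(K)\to V(G)$ such that for every edge $uv\in E(K)$ there is a path $P_{uv}$ in $G$ with endpoints $\phi(u),\phi(v)$, the paths $P_{uv}$ ($uv\in E(K)$) are pairwise edge-disjoint, and no vertex of $\phi(V(K))$ (the branch vertices) is an interior vertex of any path $P_{uv}$. -}

module Defs where

open import Data.Nat using (ℕ; _≤_)
open import Data.Fin using (Fin; _<_; _≟_)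
open import Data.Bool using (Bool; true; false; not)
open import Data.List using (List; []; _∷_; _++_; [_]; length)
open import Data.List.Relation.Unary.Unique.Propositional using (Unique)
open import Data.List.Relation.Unary.Linked using (Linked)
open import Data.List.Relation.Unary.All using (All)
open import Data.List.Relation.Unary.AllPairs using (AllPairs)
open import Data.Product using (Σ; _×_; _,_; ∃)
open import Function.Definitions using (Injective)
open import Relation.Binary.PropositionalEquality using (_≡_; _≢_)
open import Relation.Nullary using (¬_)
open import Relation.Nullary.Decidable using (⌊_⌋)

record Graph (n : ℕ) : Set where
  field
    adj    : Fin n → Fin n → Bool
    adj-sym    : ∀ u v → adj u v ≡ adj v u
    adj-irrefl : ∀ v → adj v v ≡ false
open Graph public

Adj : ∀ {n} → Graph n → Fin n → Fin n → Set
Adj G u v = adj G u v ≡ true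

complete : (k : ℕ) → Graph k
complete k = record
  { adj    = λ u v → not ⌊ u ≟ v ⌋
  ; adj-sym    = symm
  ; adj-irrefl = irr }
  where
  open import Relation.Binary.PropositionalEquality using (refl; sym)
  open import Relation.Nullary using (yes; no)
  open import Data.Empty using (⊥-elim)
  symm : ∀ u v → not ⌊ u ≟ v ⌋ ≡ not ⌊ v ≟ u ⌋
  symm u v with u ≟ v | v ≟ u
  ... | yes _ | yes _ = refl
  ... | yes p | no q = ⊥-elim (q (sym p))
  ... | no p | yes q = ⊥-elim (p (sym q))
  ... | no _ | no _ = refl
  irr : ∀ v → not ⌊ v ≟ v ⌋ ≡ false
  irr v with v ≟ v
  ... | yes _ = refl
  ... | no p = ⊥-elim (p refl)

IndependentSet : ∀ {n} → Graph n → List (Fin n) → Set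
IndependentSet G S = Unique S × AllPairs (λ u v → adj G u v ≡ false) S

α≤ : ∀ {n} → Graph n → ℕ → Set
α≤ G k = ∀ S → IndependentSet G S → length S ≤ k

InducedSub : ∀ {m n} → Graph m → Graph n → Set
InducedSub {m} {n} H G =
  Σ (Fin m → Fin n) λ φ → Injective _≡_ _≡_ φ × (∀ i j → adj G (φ i) (φ j) ≡ adj H i j)

Free : ∀ {m n} → Graph m → Graph n → Set
Free H G = ¬ InducedSub H G

data Consec {n : ℕ} : List (Fin n) → Fin n → Fin n → Set where
  here  : ∀ {a b} rest → Consec (a ∷ b ∷ rest) a b
  there : ∀ {x l a b} → Consec l a b → Consec (x ∷ l) a b

record Path {n : ℕ} (G : Graph n) (x y : Fin n) : Set where
  field
    interior : List (Fin n)
  verts : List (Fin n)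
  verts = x ∷ (interior ++ [ y ])
  field
    distinct : Unique verts
    linked   : Linked (Adj G) verts
open Path public

UsesEdge : ∀ {n} {G : Graph n} {x y} → Path G x y → Fin n → Fin n → Set
UsesEdge P a b = Consec (verts P) a b

Immersion : ∀ {k n} → Graph k → Graph n → Set
Immersion {k} {n} K G =
  Σ (Fin k → Fin n) λ φ → Injective _≡_ _≡_ φ ×
  Σ (∀ u v → u < v → Adj K u v → Path G (φ u) (φ v)) λ P →
    (∀ u v u' v' (p : u < v) (e : Adj K u v) (p' : u' < v') (e' : Adj K u' v') →
       ¬ (u ≡ u' × v ≡ v') →
       ∀ a b → UsesEdge (P u v p e) a b →
         ¬ UsesEdge (P u' v' p' e') a b × ¬ UsesEdge (P u' v' p' e') b a)
    ×
    (∀ u v (p : u < v) (e : Adj K u v) →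
       All (λ w → ∀ z → φ z ≢ w) (interior (P u v p e)))

{-# OPTIONS --safe #-}
-- Let co be the complement of G; α(G) ≤ 2 says that co is triangle-free.  If x and y are joined in co,
-- G − x − y contains an immersion with branch set S, and the number of co-neighbours of x in S is at most
-- the number of vertices outside S that are G-adjacent to both x and y, then x can be added to S: x reaches each
-- co-neighbour s ∈ S along x – w – y – s, with a different w for each s.  Counting shows that x or y can be
-- added, unless S is already large enough, as soon as |N(x)| + |N(y)| ≤ |B| + 4, where N(v) is the
-- co-neighbourhood of v and B = V ∖ (N(x) ∪ N(y)); so one may induct by deleting the two ends of a co-edge.
--
-- It suffices to treat H on four vertices, that is, to let co avoid one of the seven triangle-free graphs on
-- four vertices.  Whenever the inequality fails for a co-edge, G is covered by two cliques, or has a clique of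
-- size ⌈n/2⌉, or has another co-edge for which it holds.  The exceptions are P₄, where induction produces a clique,
-- and 2K₂, where co is bipartite or a blow-up of a 5-cycle together with isolated vertices: there the same
-- extension step is iterated starting from a clique.
module Submission where

open import Defs
open import Data.Nat using (ℕ; zero; suc; _+_; _≤_; z≤n; s≤s; _≤?_; _⊓_; ⌈_/2⌉)
open import Data.Nat.Properties hiding (_≟_; 0≢1+n; suc-injective; <⇒≢; <-asym)
open import Data.Nat.Tactic.RingSolver using (solve-∀)
open import Data.Bool as Bool using (Bool; true; false; not; _∧_; _∨_)
open import Data.Bool.Properties using (∧-conicalˡ; ∧-conicalʳ; ¬-not; ∨-zeroʳ)
open import Data.Fin as Fin using (Fin; zero; suc; _≟_; inject≤)
open import Data.Fin.Properties using (suc-injective; inject≤-injective; any?; <⇒≢; <-asym)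
open import Data.List using (List; []; _∷_)
open import Data.List.Relation.Unary.All as All using (All; []; _∷_)
open import Data.List.Relation.Unary.All.Properties using (++⁺)
open import Data.List.Relation.Unary.AllPairs using ([]; _∷_)
open import Data.List.Relation.Unary.Linked using ([-]; _∷_)
open import Data.Product using (∃; _×_; _,_; proj₁; proj₂)
open import Data.Sum using (_⊎_; inj₁; inj₂; [_,_]′)
open import Data.Empty using (⊥; ⊥-elim)
open import Function using (_∘_)
open import Relation.Binary.PropositionalEquality using (_≡_; _≢_; refl; sym; trans; cong; cong₂; subst; ≢-sym)
open import Relation.Nullary using (¬_; ¬?; Dec; yes; no; does)
open import Relation.Nullary.Decidable
  using (True; toWitness; map′; _×-dec_; _⊎-dec_; _→-dec_; dec-true; dec-false; decidable-stable)

-- A co-edge xy that violates the inequality is not a mere loss: `co` is triangle-free, so N(x) and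
-- N(y) are disjoint cliques of G that together outnumber B by more than 4. Only B and the co-edges
-- between N(x) and N(y) keep G from having a huge clique or a cover by two cliques, and an excluded
-- pattern restricts these co-edges, the sizes of N(x) and N(y), or the way B is joined to them.
-- Patterns excluded from `co` stay excluded on subsets, so the induction runs over subsets W of one
-- fixed vertex set and no graph is reindexed.
--
-- The pattern 2K₂ resists this scheme. If `co` blows each vertex of a 5-cycle up to k ≥ 2 vertices,
-- then every co-edge has |N(x)| + |N(y)| = 4k > k + 4 = |B| + 4, while the largest cliques of G
-- have 2k < 5k/2 vertices. There the immersion is built in the whole graph at once, and the
-- relative sizes of the five classes decide which of them supply branch vertices and which supply
-- the interior of the detours.

-- Finite subsets and counting by truth tables

Subset : ℕ → Set
Subset n = Fin n → Bool

module _ {n : ℕ} where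
  infix 4 _∈_ _∉_ _⊆_
  infixr 7 _∩_
  infixr 6 _∪_

  _∈_ _∉_ : Fin n → Subset n → Set
  v ∈ p = p v ≡ true
  v ∉ p = p v ≡ false

  _⊆_ : Subset n → Subset n → Set
  p ⊆ q = ∀ {v} → v ∈ p → v ∈ q

  _∩_ _∪_ : Subset n → Subset n → Subset n
  (p ∩ q) v = p v ∧ q v
  (p ∪ q) v = p v ∨ q v

  ∁ : Subset n → Subset n
  ∁ p v = not (p v)

  ⁅_⁆ : Fin n → Subset n
  ⁅ x ⁆ v = does (v ≟ x)

bit : Bool → ℕ
bit false = 0
bit true  = 1

# : ∀ {n} → Subset n → ℕ
# {zero}  p = 0
# {suc n} p = bit (p zero) + # (p ∘ suc)

tally : ∀ {n} → Subset n → List (Subset n) → Fin n → ℕ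
tally p []       v = bit (p v)
tally p (q ∷ qs) v = bit (p v) + tally q qs v

total : ∀ {n} → Subset n → List (Subset n) → ℕ
total p []       = # p
total p (q ∷ qs) = # p + total q qs

private
  interchange : ∀ a b c d → (a + b) + (c + d) ≡ (a + c) + (b + d)
  interchange = solve-∀

Σtally : ∀ {n} → (Fin n → ℕ) → ℕ
Σtally {zero}  f = 0
Σtally {suc n} f = f zero + Σtally (f ∘ suc)

Σtally-+ : ∀ {n} (f g : Fin n → ℕ) → Σtally (λ v → f v + g v) ≡ Σtally f + Σtally g
Σtally-+ {zero}  f g = refl
Σtally-+ {suc n} f g rewrite Σtally-+ (f ∘ suc) (g ∘ suc) =
  interchange (f zero) (g zero) (Σtally (f ∘ suc)) (Σtally (g ∘ suc))

Σtally-mono : ∀ {n} {f g : Fin n → ℕ} → (∀ v → f v ≤ g v) → Σtally f ≤ Σtally g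
Σtally-mono {zero}  f≤g = z≤n
Σtally-mono {suc n} f≤g = +-mono-≤ (f≤g zero) (Σtally-mono (f≤g ∘ suc))

#-as-Σ : ∀ {n} (p : Subset n) → # p ≡ Σtally (bit ∘ p)
#-as-Σ {zero}  p = refl
#-as-Σ {suc n} p = cong (bit (p zero) +_) (#-as-Σ (p ∘ suc))

total-as-Σ : ∀ {n} (p : Subset n) ps → total p ps ≡ Σtally (tally p ps)
total-as-Σ p []       = #-as-Σ p
total-as-Σ p (q ∷ qs) = trans (cong₂ _+_ (#-as-Σ p) (total-as-Σ q qs)) (sym (Σtally-+ (bit ∘ p) (tally q qs)))

-- Double counting: an inequality between sums of cardinalities follows once it holds for the number
-- of memberships of each single vertex. That condition concerns finitely many Booleans, so most of
-- the lemmas `taut` below settle it by exhausting a truth table.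
total-mono : ∀ {n} (p : Subset n) ps q qs → (∀ v → tally p ps v ≤ tally q qs v) → total p ps ≤ total q qs
total-mono p ps q qs le =
  subst (_≤ total q qs) (sym (total-as-Σ p ps)) (subst (_ ≤_) (sym (total-as-Σ q qs)) (Σtally-mono le))

#-mono : ∀ {n} {p q : Subset n} → p ⊆ q → # p ≤ # q
#-mono {p = p} {q} p⊆q = total-mono p [] q [] λ v → bit-mono (p v) (q v) p⊆q
  where
  bit-mono : ∀ a b → (a ≡ true → b ≡ true) → bit a ≤ bit b
  bit-mono false _ _ = z≤n
  bit-mono true  b h rewrite h refl = s≤s z≤n

#-empty : ∀ {n} (p : Subset n) → (∀ v → v ∉ p) → # p ≡ 0
#-empty {zero}  p e = refl
#-empty {suc n} p e rewrite e zero = #-empty (p ∘ suc) (e ∘ suc)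

#-singleton : ∀ {n} (x : Fin n) → # ⁅ x ⁆ ≡ 1
#-singleton {suc n} zero = cong suc (#-empty {n} _ λ _ → refl)
#-singleton {suc n} (suc x) = #-singleton x

private
  pick : ∀ {k n} b → (Fin k → Fin n) → Fin (bit b + k) → Fin (suc n)
  pick false e i       = suc (e i)
  pick true  e zero    = zero
  pick true  e (suc i) = suc (e i)

  pick-injective : ∀ {k n} b {e : Fin k → Fin n} → (∀ {i j} → e i ≡ e j → i ≡ j) →
                   ∀ {i j} → pick b e i ≡ pick b e j → i ≡ j
  pick-injective false inj eq = inj (suc-injective eq)
  pick-injective true  inj {zero}  {zero}  eq = refl
  pick-injective true  inj {suc i} {suc j} eq = cong suc (inj (suc-injective eq))

  pick-∈ : ∀ {k n} b {e : Fin k → Fin n} (p : Subset (suc n)) → b ≡ p zero → (∀ i → e i ∈ p ∘ suc) →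
           ∀ i → pick b e i ∈ p
  pick-∈ false p eq h i       = h i
  pick-∈ true  p eq h zero    = sym eq
  pick-∈ true  p eq h (suc i) = h i

  pick-zero : ∀ {k n} b (e : Fin k → Fin n) → b ≡ true → ∃ λ i → pick b e i ≡ zero
  pick-zero true e refl = zero , refl

  pick-suc : ∀ {k n} b (e : Fin k → Fin n) i → ∃ λ j → pick b e j ≡ suc (e i)
  pick-suc false e i = i , refl
  pick-suc true  e i = suc i , refl

enum : ∀ {n} (p : Subset n) → Fin (# p) → Fin n
enum {suc n} p = pick (p zero) (enum (p ∘ suc))

enum-injective : ∀ {n} (p : Subset n) {i j} → enum p i ≡ enum p j → i ≡ j
enum-injective {suc n} p = pick-injective (p zero) (enum-injective (p ∘ suc))

enum-∈ : ∀ {n} (p : Subset n) i → enum p i ∈ p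
enum-∈ {suc n} p = pick-∈ (p zero) p refl (enum-∈ (p ∘ suc))

rank : ∀ {n} (p : Subset n) {v} → v ∈ p → ∃ λ i → enum p i ≡ v
rank {suc n} p {zero}  v∈p = pick-zero (p zero) _ v∈p
rank {suc n} p {suc v} v∈p with rank (p ∘ suc) v∈p
... | i , refl = pick-suc (p zero) _ i

matching : ∀ {n} (p q : Subset n) → # p ≤ # q →
           ∃ λ (g : Fin n → Fin n) → (∀ {v} → v ∈ p → g v ∈ q) × (∀ {u v} → u ∈ p → v ∈ p → g u ≡ g v → u ≡ v)
matching p q le = g , g-∈ , g-injective
  where
  image : ∀ {v} → v ∈ p → Fin _
  image v∈p = enum q (inject≤ (proj₁ (rank p v∈p)) le)

  g : Fin _ → Fin _
  g v with p v Bool.≟ true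
  ... | yes v∈p = image v∈p
  -- An arbitrary value: only the restriction of `g` to `p` matters.
  ... | no  _   = v

  g-∈ : ∀ {v} → v ∈ p → g v ∈ q
  g-∈ {v} v∈p with p v Bool.≟ true
  ... | yes _  = enum-∈ q _
  ... | no v∉p = ⊥-elim (v∉p v∈p)

  g-injective : ∀ {u v} → u ∈ p → v ∈ p → g u ≡ g v → u ≡ v
  g-injective {u} {v} u∈p v∈p eq with p u Bool.≟ true | p v Bool.≟ true
  ... | no u∉p  | _       = ⊥-elim (u∉p u∈p)
  ... | yes _   | no v∉p  = ⊥-elim (v∉p v∈p)
  ... | yes u∈p | yes v∈p with rank p u∈p | rank p v∈p
  ... | i , refl | j , refl = cong (enum p) (inject≤-injective le le i j (enum-injective q eq))

choose : ∀ {n} (p : Subset n) k → k ≤ # p →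
         ∃ λ (e : Fin k → Fin n) → (∀ i → e i ∈ p) × (∀ {i j} → i ≢ j → e i ≢ e j)
choose p k le = (λ i → enum p (inject≤ i le)) , (λ i → enum-∈ p _)
              , λ {i} {j} i≢j eq → i≢j (inject≤-injective le le i j (enum-injective p eq))

subset-of-size : ∀ {n} (p : Subset n) k → k ≤ # p → ∃ λ q → (q ⊆ p) × # q ≡ k
subset-of-size {zero}  p zero    le = p , (λ v∈p → v∈p) , refl
subset-of-size {suc n} p k le = go (p zero) refl k le
  where
  cons : Bool → Subset n → Subset (suc n)
  cons b q zero    = b
  cons b q (suc v) = q v

  go : ∀ b → b ≡ p zero → ∀ k → k ≤ bit b + # (p ∘ suc) → ∃ λ q → (q ⊆ p) × # q ≡ k
  go true  eq (suc k) (s≤s le) with subset-of-size (p ∘ suc) k le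
  ... | q , q⊆ , sz = cons true q , (λ { {zero} _ → sym eq ; {suc v} → q⊆ }) , cong suc sz
  go true  eq zero    le       = (λ _ → false) , (λ ()) , #-empty {suc n} _ (λ _ → refl)
  go false eq k       le       with subset-of-size (p ∘ suc) k le
  ... | q , q⊆ , sz = cons false q , (λ { {suc v} → q⊆ }) , sz

inhabited : ∀ {n} (p : Subset n) → 1 ≤ # p → ∃ λ v → v ∈ p
inhabited p le with choose p 1 le
... | e , e∈ , _ = e zero , e∈ zero

all-Bool? : {P : Bool → Set} → (∀ b → Dec (P b)) → Dec (∀ b → P b)
all-Bool? P? = map′ (λ { (f , t) false → f ; (f , t) true → t }) (λ h → h false , h true) (P? false ×-dec P? true)

infixr 2 _⇒?_
_⇒?_ : ∀ {A B : Set} → Dec A → Dec B → Dec (A → B)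
_⇒?_ = _→-dec_

decided : ∀ {A : Set} (A? : Dec A) → {True A?} → A
decided A? {t} = toWitness t

module _ {n : ℕ} where
  ∈-∉ : ∀ {p : Subset n} {v} → v ∈ p → v ∉ p → ⊥
  ∈-∉ v∈p v∉p with trans (sym v∈p) v∉p
  ... | ()

  ∉⇒≢ : ∀ {p : Subset n} {u v} → u ∈ p → v ∉ p → u ≢ v
  ∉⇒≢ {p} u∈p v∉p refl = ∈-∉ {p} u∈p v∉p

  ∈-∩ : ∀ {p q : Subset n} {v} → v ∈ p → v ∈ q → v ∈ p ∩ q
  ∈-∩ v∈p v∈q rewrite v∈p = v∈q

  ∩-⊆ˡ : ∀ {p q : Subset n} → p ∩ q ⊆ p
  ∩-⊆ˡ {p} {q} {v} = ∧-conicalˡ (p v) (q v)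

  ∩-⊆ʳ : ∀ {p q : Subset n} → p ∩ q ⊆ q
  ∩-⊆ʳ {p} {q} {v} = ∧-conicalʳ (p v) (q v)

  ∪-⊆ˡ : ∀ {p q : Subset n} → p ⊆ p ∪ q
  ∪-⊆ˡ v∈p rewrite v∈p = refl

  ∪-⊆ʳ : ∀ {p q : Subset n} → q ⊆ p ∪ q
  ∪-⊆ʳ {p} {q} {v} v∈q rewrite v∈q = ∨-zeroʳ (p v)

  ∪-case : ∀ {p q : Subset n} {v} → v ∈ p ∪ q → v ∈ p ⊎ v ∈ q
  ∪-case {p} {q} {v} v∈ with p v
  ... | true  = inj₁ refl
  ... | false = inj₂ v∈

  ∉⇒∈∁ : ∀ {p : Subset n} {v} → v ∉ p → v ∈ ∁ p
  ∉⇒∈∁ v∉p rewrite v∉p = refl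

  ∈∁⇒∉ : ∀ {p : Subset n} {v} → v ∈ ∁ p → v ∉ p
  ∈∁⇒∉ {p} {v} h with p v
  ... | false = refl

  ∈-⁅⁆ : ∀ (x : Fin n) → x ∈ ⁅ x ⁆
  ∈-⁅⁆ x = dec-true (x ≟ x) refl

  ⁅⁆-≡ : ∀ {x v : Fin n} → v ∈ ⁅ x ⁆ → v ≡ x
  ⁅⁆-≡ {x} {v} h with v ≟ x
  ... | yes eq = eq

  ∉-⁅⁆ : ∀ {x v : Fin n} → v ≢ x → v ∉ ⁅ x ⁆
  ∉-⁅⁆ {x} {v} = dec-false (v ≟ x)

  ∉-⊆ : ∀ {p q : Subset n} {v} → p ⊆ q → v ∉ q → v ∉ p
  ∉-⊆ {p} {q} p⊆q v∉q = ¬-not (λ v∈p → ∈-∉ {q} (p⊆q v∈p) v∉q)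

Traverses : ∀ {n} {G : Graph n} {x y} → Path G x y → Fin n → Fin n → Set
Traverses P a b = UsesEdge P a b ⊎ UsesEdge P b a

Consec-All : ∀ {n} {Q : Fin n → Set} {l a b} → All Q l → Consec l a b → Q a × Q b
Consec-All (p ∷ q ∷ _) (here _)  = p , q
Consec-All (_ ∷ ps)    (there c) = Consec-All ps c

-- The one consequence of α ≤ 2 on which everything rests, stated without lists so that it can be
-- checked on four-vertex graphs and carried over to `cone`.
TripleFree : ∀ {m} → Graph m → Set
TripleFree {m} H = ∀ {i j k : Fin m} → i ≢ j → i ≢ k → j ≢ k → adj H i j ≡ false → adj H i k ≡ false → adj H j k ≡ false → ⊥

α≤2⇒triple-free : ∀ {m} {H : Graph m} → α≤ H 2 → TripleFree H
α≤2⇒triple-free α {i} {j} {k} ij ik jk ¬ij ¬ik ¬jk = 1+n≰n (α (i ∷ j ∷ k ∷ [])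
  ( ((ij ∷ ik ∷ []) ∷ (jk ∷ []) ∷ [] ∷ []) , ((¬ij ∷ ¬ik ∷ []) ∷ (¬jk ∷ []) ∷ [] ∷ [])))

-- Immersions in graphs of independence number two

module Independence2 {n : ℕ} (G : Graph n) (α : α≤ G 2) where

  V : Set
  V = Fin n

  co : V → Subset n
  co u v = not (does (u ≟ v)) ∧ not (adj G u v)

  co-irrefl : ∀ v → v ∉ co v
  co-irrefl v rewrite dec-true (v ≟ v) refl = refl

  co⇒≢ : ∀ {u v} → v ∈ co u → u ≢ v
  co⇒≢ {u} uv refl = ∈-∉ {p = co u} uv (co-irrefl u)

  co⇒¬adj : ∀ {u v} → v ∈ co u → adj G u v ≡ false
  co⇒¬adj {u} {v} uv with does (u ≟ v) | adj G u v
  ... | false | false = refl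

  ¬adj⇒co : ∀ {u v} → u ≢ v → adj G u v ≡ false → v ∈ co u
  ¬adj⇒co {u} {v} u≢v na rewrite dec-false (u ≟ v) u≢v | na = refl

  ¬co⇒Adj : ∀ {u v} → u ≢ v → v ∉ co u → Adj G u v
  ¬co⇒Adj {u} {v} u≢v nc rewrite dec-false (u ≟ v) u≢v with adj G u v
  ... | true = refl

  co-sym : ∀ {u v} → v ∈ co u → u ∈ co v
  co-sym {u} {v} uv = ¬adj⇒co (≢-sym (co⇒≢ uv)) (trans (adj-sym G v u) (co⇒¬adj uv))

  ¬co-sym : ∀ {u v} → v ∉ co u → u ∉ co v
  ¬co-sym {u} {v} = ∉-⊆ {p = λ _ → co v u} {q = λ _ → co u v} {v = u} co-sym

  co-triangle-free : ∀ {u v w} → v ∈ co u → w ∈ co v → w ∉ co u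
  co-triangle-free uv vw = ¬-not λ uw →
    α≤2⇒triple-free {H = G} α (co⇒≢ uv) (co⇒≢ uw) (co⇒≢ vw) (co⇒¬adj uv) (co⇒¬adj uw) (co⇒¬adj vw)

  no-triangle : ∀ {u v w} → v ∈ co u → w ∈ co v → w ∈ co u → ⊥
  no-triangle {u} uv vw uw = ∈-∉ {p = co u} uw (co-triangle-free uv vw)

  edge : ∀ {s t} → Adj G s t → Path G s t
  edge {s} {t} st = record { interior = [] ; distinct = (Adj⇒≢ st ∷ []) ∷ [] ∷ [] ; linked = st ∷ [-] }
    where
    Adj⇒≢ : ∀ {u v} → Adj G u v → u ≢ v
    Adj⇒≢ {u} uv refl with trans (sym uv) (adj-irrefl G u)
    ... | ()

  -- An immersion of the complete graph on `S` that stays inside `W`; vertices outside `W` remain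
  -- untouched, which is what makes an extension possible. The paths from s to t and from t to s are
  -- given separately and may share edges, so `disjoint` identifies the ends only as an unordered
  -- pair.
  record Immersed (W S : Subset n) : Set where
    field
      S⊆W       : S ⊆ W
      path      : ∀ {s t} → s ∈ S → t ∈ S → s ≢ t → Path G s t
      interior∈ : ∀ {s t} (p : s ∈ S) (q : t ∈ S) (r : s ≢ t) → All (λ w → w ∈ W × w ∉ S) (interior (path p q r))
      disjoint  : ∀ {s t s′ t′} (p : s ∈ S) (q : t ∈ S) (r : s ≢ t) (p′ : s′ ∈ S) (q′ : t′ ∈ S) (r′ : s′ ≢ t′) {a b} →
                  Traverses (path p q r) a b → Traverses (path p′ q′ r′) a b →
                  (s ≡ s′ × t ≡ t′) ⊎ (s ≡ t′ × t ≡ s′)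

  open Immersed

  Clique : Subset n → Set
  Clique Q = ∀ {u v} → u ∈ Q → v ∈ Q → v ∉ co u

  clique-immersed : ∀ {W Q} → Q ⊆ W → Clique Q → Immersed W Q
  clique-immersed Q⊆W cl = record
    { S⊆W       = Q⊆W
    ; path      = λ p q r → edge (¬co⇒Adj r (cl p q))
    ; interior∈ = λ _ _ _ → []
    ; disjoint  = λ _ _ _ _ _ _ → λ
        { (inj₁ (here _)) (inj₁ (here _)) → inj₁ (refl , refl)
        ; (inj₁ (here _)) (inj₂ (here _)) → inj₂ (refl , refl)
        ; (inj₂ (here _)) (inj₁ (here _)) → inj₂ (refl , refl)
        ; (inj₂ (here _)) (inj₂ (here _)) → inj₁ (refl , refl)
        ; (inj₁ (there (there ()))) _
        ; (inj₂ (there (there ()))) _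
        ; _ (inj₁ (there (there ())))
        ; _ (inj₂ (there (there ()))) } }

  immersed-mono : ∀ {W W′ S} → W ⊆ W′ → Immersed W S → Immersed W′ S
  immersed-mono {W} {W′} W⊆ I = record
    { S⊆W       = λ v∈S → W⊆ (S⊆W I v∈S)
    ; path      = path I
    ; interior∈ = λ p q r → All.map (λ { (w∈ , w∉) → W⊆ w∈ , w∉ }) (interior∈ I p q r)
    ; disjoint  = disjoint I }

  -- The new branch vertex x reaches a branch vertex t that it misses along x – g t – y – t:
  -- t is adjacent to y because x, y, t are not independent.
  module Extend {W S : Subset n} (I : Immersed W S) {x y : V} (xy : y ∈ co x) (x∉W : x ∉ W) (y∉W : y ∉ W)
                (g : V → V)
                (g∈W : ∀ {v} → v ∈ S ∩ co x → g v ∈ W) (g∉S : ∀ {v} → v ∈ S ∩ co x → g v ∉ S)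
                (g≁x : ∀ {v} → v ∈ S ∩ co x → g v ∉ co x) (g≁y : ∀ {v} → v ∈ S ∩ co x → g v ∉ co y)
                (g-inj : ∀ {u v} → u ∈ S ∩ co x → v ∈ S ∩ co x → g u ≡ g v → u ≡ v)
                where

    W⁺ S⁺ : Subset n
    W⁺ = W ∪ ⁅ x ⁆ ∪ ⁅ y ⁆
    S⁺ = S ∪ ⁅ x ⁆

    Hub : V → Set
    Hub v = v ≡ x ⊎ v ≡ y

    Spoke : V → V → Set
    Spoke t v = v ≡ t ⊎ (t ∈ S ∩ co x × v ≡ g t)

    hub∉W : ∀ {v} → Hub v → v ∉ W
    hub∉W (inj₁ refl) = x∉W
    hub∉W (inj₂ refl) = y∉W

    W≢hub : ∀ {v h} → v ∈ W → Hub h → v ≢ h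
    W≢hub v∈W h = ∉⇒≢ {p = W} v∈W (hub∉W h)

    module Detour {t} (t∈S : t ∈ S) (xt : t ∈ co x) where
      t∈ : t ∈ S ∩ co x
      t∈ = ∈-∩ {p = S} {q = co x} t∈S xt

      t≢x : t ≢ x
      t≢x = W≢hub (S⊆W I t∈S) (inj₁ refl)

      t≢y : t ≢ y
      t≢y = W≢hub (S⊆W I t∈S) (inj₂ refl)

      w≢x : g t ≢ x
      w≢x = W≢hub (g∈W t∈) (inj₁ refl)

      w≢y : g t ≢ y
      w≢y = W≢hub (g∈W t∈) (inj₂ refl)

      t≢w : t ≢ g t
      t≢w = ∉⇒≢ {p = S} t∈S (g∉S t∈)

      yt : Adj G y t
      yt = ¬co⇒Adj (≢-sym t≢y) (co-triangle-free (co-sym xy) xt)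

      xw : Adj G x (g t)
      xw = ¬co⇒Adj (≢-sym w≢x) (g≁x t∈)

      wy : Adj G (g t) y
      wy = ¬co⇒Adj w≢y (¬co-sym (g≁y t∈))

    flip : ∀ {u v} → Adj G u v → Adj G v u
    flip {u} {v} uv = trans (adj-sym G v u) uv

    -- `b` stands for `co x t`, so that the path unfolds after a case split on `b`, both here and
    -- where its edges and its interior are listed.
    outward : ∀ {t} → t ∈ S → ∀ b → b ≡ co x t → Path G x t
    outward t∈S false eq = edge (¬co⇒Adj (≢-sym (W≢hub (S⊆W I t∈S) (inj₁ refl))) (sym eq))
    outward {t} t∈S true eq = record
      { interior = g t ∷ y ∷ []
      ; distinct = (≢-sym w≢x ∷ co⇒≢ xy ∷ ≢-sym t≢x ∷ []) ∷ (w≢y ∷ ≢-sym t≢w ∷ []) ∷ (≢-sym t≢y ∷ []) ∷ [] ∷ []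
      ; linked   = xw ∷ wy ∷ yt ∷ [-] }
      where open Detour t∈S (sym eq)

    inward : ∀ {t} → t ∈ S → ∀ b → b ≡ co x t → Path G t x
    inward t∈S false eq = edge (flip (¬co⇒Adj (≢-sym (W≢hub (S⊆W I t∈S) (inj₁ refl))) (sym eq)))
    inward {t} t∈S true eq = record
      { interior = y ∷ g t ∷ []
      ; distinct = (t≢y ∷ t≢w ∷ t≢x ∷ []) ∷ (≢-sym w≢y ∷ ≢-sym (co⇒≢ xy) ∷ []) ∷ (w≢x ∷ []) ∷ [] ∷ []
      ; linked   = flip yt ∷ flip wy ∷ flip xw ∷ [-] }
      where open Detour t∈S (sym eq)

    data Ends : V → V → Set where
      old : ∀ {s t} → s ∈ S → t ∈ S → s ≢ t → Ends s t
      out : ∀ {t} → t ∈ S → Ends x t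
      inn : ∀ {s} → s ∈ S → Ends s x

    ends : ∀ {s t} → s ∈ S⁺ → t ∈ S⁺ → s ≢ t → Ends s t
    ends {s} {t} p q r with ∪-case {p = S} {q = ⁅ x ⁆} p | ∪-case {p = S} {q = ⁅ x ⁆} q
    ... | inj₁ s∈S | inj₁ t∈S = old s∈S t∈S r
    ... | inj₁ s∈S | inj₂ t≡x rewrite ⁅⁆-≡ {x = x} {v = t} t≡x = inn s∈S
    ... | inj₂ s≡x | inj₁ t∈S rewrite ⁅⁆-≡ {x = x} {v = s} s≡x = out t∈S
    ... | inj₂ s≡x | inj₂ t≡x = ⊥-elim (r (trans (⁅⁆-≡ s≡x) (sym (⁅⁆-≡ t≡x))))

    route : ∀ {s t} → Ends s t → Path G s t
    route (old p q r) = path I p q r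
    route (out t∈S)   = outward t∈S _ refl
    route (inn s∈S)   = inward s∈S _ refl

    W⊆W⁺ : W ⊆ W⁺
    W⊆W⁺ = ∪-⊆ˡ {p = W} {q = ⁅ x ⁆ ∪ ⁅ y ⁆}

    x∈W⁺ : x ∈ W⁺
    x∈W⁺ = ∪-⊆ʳ {p = W} {q = ⁅ x ⁆ ∪ ⁅ y ⁆} {v = x} (∪-⊆ˡ {p = ⁅ x ⁆} {q = ⁅ y ⁆} {v = x} (∈-⁅⁆ x))

    y∈W⁺ : y ∈ W⁺
    y∈W⁺ = ∪-⊆ʳ {p = W} {q = ⁅ x ⁆ ∪ ⁅ y ⁆} {v = y} (∪-⊆ʳ {p = ⁅ x ⁆} {q = ⁅ y ⁆} {v = y} (∈-⁅⁆ y))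

    ∉S⁺ : ∀ {v} → v ∉ S → v ≢ x → v ∉ S⁺
    ∉S⁺ v∉S v≢x rewrite v∉S = ∉-⁅⁆ v≢x

    y-inner : y ∈ W⁺ × y ∉ S⁺
    y-inner = y∈W⁺ , ∉S⁺ (∉-⊆ {p = S} {q = W} (S⊆W I) y∉W) (≢-sym (co⇒≢ xy))

    g-inner : ∀ {t} → t ∈ S → t ∈ co x → g t ∈ W⁺ × g t ∉ S⁺
    g-inner t∈S xt = W⊆W⁺ (g∈W t∈) , ∉S⁺ (g∉S t∈) w≢x
      where open Detour t∈S xt

    outward-interior : ∀ {t} (t∈S : t ∈ S) b (eq : b ≡ co x t) → All (λ w → w ∈ W⁺ × w ∉ S⁺) (interior (outward t∈S b eq))
    outward-interior t∈S false eq = []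
    outward-interior t∈S true  eq = g-inner t∈S (sym eq) ∷ y-inner ∷ []

    inward-interior : ∀ {t} (t∈S : t ∈ S) b (eq : b ≡ co x t) → All (λ w → w ∈ W⁺ × w ∉ S⁺) (interior (inward t∈S b eq))
    inward-interior t∈S false eq = []
    inward-interior t∈S true  eq = y-inner ∷ g-inner t∈S (sym eq) ∷ []

    route-interior : ∀ {s t} (e : Ends s t) → All (λ w → w ∈ W⁺ × w ∉ S⁺) (interior (route e))
    route-interior (old p q r) =
      All.map (λ { (w∈W , w∉S) → W⊆W⁺ w∈W , ∉S⁺ w∉S (W≢hub w∈W (inj₁ refl)) }) (interior∈ I p q r)
    route-interior (out t∈S) = outward-interior t∈S _ refl
    route-interior (inn s∈S) = inward-interior s∈S _ refl

    -- Each edge of a new path joins a hub outside `W` to a vertex of `W`. Old paths stay inside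
    -- `W`, hence share no edge with new ones. The end in `W` determines t: it is t itself, in `S`,
    -- or `g t`, off `S`, and `g` is injective.
    SpokeEdge : V → V → V → Set
    SpokeEdge t a b = (Hub a × Spoke t b) ⊎ (Hub b × Spoke t a)

    outward-edges : ∀ {t} (t∈S : t ∈ S) b (eq : b ≡ co x t) {c d} → UsesEdge (outward t∈S b eq) c d → SpokeEdge t c d
    outward-edges t∈S false eq (here _)                         = inj₁ (inj₁ refl , inj₁ refl)
    outward-edges t∈S true  eq (here _)                         = inj₁ (inj₁ refl , inj₂ (Detour.t∈ t∈S (sym eq) , refl))
    outward-edges t∈S true  eq (there (here _))                 = inj₂ (inj₂ refl , inj₂ (Detour.t∈ t∈S (sym eq) , refl))
    outward-edges t∈S true  eq (there (there (here _)))         = inj₁ (inj₂ refl , inj₁ refl)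
    outward-edges t∈S true  eq (there (there (there (there ()))))
    outward-edges t∈S false eq (there (there ()))

    inward-edges : ∀ {t} (t∈S : t ∈ S) b (eq : b ≡ co x t) {c d} → UsesEdge (inward t∈S b eq) c d → SpokeEdge t c d
    inward-edges t∈S false eq (here _)                         = inj₂ (inj₁ refl , inj₁ refl)
    inward-edges t∈S true  eq (here _)                         = inj₂ (inj₂ refl , inj₁ refl)
    inward-edges t∈S true  eq (there (here _))                 = inj₁ (inj₂ refl , inj₂ (Detour.t∈ t∈S (sym eq) , refl))
    inward-edges t∈S true  eq (there (there (here _)))         = inj₂ (inj₁ refl , inj₂ (Detour.t∈ t∈S (sym eq) , refl))
    inward-edges t∈S true  eq (there (there (there (there ()))))
    inward-edges t∈S false eq (there (there ()))

    swap-spoke : ∀ {t a b} → SpokeEdge t a b → SpokeEdge t b a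
    swap-spoke (inj₁ e) = inj₂ e
    swap-spoke (inj₂ e) = inj₁ e

    outward-traverses : ∀ {t} (t∈S : t ∈ S) {a b} → Traverses (outward t∈S _ refl) a b → SpokeEdge t a b
    outward-traverses t∈S = [ outward-edges t∈S _ refl , (λ e → swap-spoke (outward-edges t∈S _ refl e)) ]′

    inward-traverses : ∀ {t} (t∈S : t ∈ S) {a b} → Traverses (inward t∈S _ refl) a b → SpokeEdge t a b
    inward-traverses t∈S = [ inward-edges t∈S _ refl , (λ e → swap-spoke (inward-edges t∈S _ refl e)) ]′

    old-traverses : ∀ {s t} (p : s ∈ S) (q : t ∈ S) (r : s ≢ t) {a b} → Traverses (path I p q r) a b → a ∈ W × b ∈ W
    old-traverses p q r = [ Consec-All within , (λ e → let b∈ , a∈ = Consec-All within e in a∈ , b∈) ]′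
      where
      within : All (_∈ W) (verts (path I p q r))
      within = S⊆W I p ∷ ++⁺ (All.map proj₁ (interior∈ I p q r)) (S⊆W I q ∷ [])

    spoke∈W : ∀ {t v} → t ∈ S → Spoke t v → v ∈ W
    spoke∈W t∈S (inj₁ refl)        = S⊆W I t∈S
    spoke∈W t∈S (inj₂ (t∈ , refl)) = g∈W t∈

    hub-clash : ∀ {h} {A : Set} → h ∈ W → Hub h → A
    hub-clash h∈W h = ⊥-elim (∈-∉ {p = W} h∈W (hub∉W h))

    old-vs-spoke : ∀ {t a b} {A : Set} → a ∈ W × b ∈ W → SpokeEdge t a b → A
    old-vs-spoke (a∈ , b∈) (inj₁ (h , _)) = hub-clash a∈ h
    old-vs-spoke (a∈ , b∈) (inj₂ (h , _)) = hub-clash b∈ h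

    spoke-unique : ∀ {t t′ v} → t ∈ S → t′ ∈ S → Spoke t v → Spoke t′ v → t ≡ t′
    spoke-unique t∈S t′∈S (inj₁ refl)        (inj₁ refl)         = refl
    spoke-unique t∈S t′∈S (inj₁ refl)        (inj₂ (t′∈ , refl)) = ⊥-elim (∈-∉ {p = S} t∈S (g∉S t′∈))
    spoke-unique t∈S t′∈S (inj₂ (t∈ , refl)) (inj₁ refl)         = ⊥-elim (∈-∉ {p = S} t′∈S (g∉S t∈))
    spoke-unique t∈S t′∈S (inj₂ (t∈ , refl)) (inj₂ (t′∈ , eq))   = g-inj t∈ t′∈ eq

    spokes-meet : ∀ {t t′ a b} → t ∈ S → t′ ∈ S → SpokeEdge t a b → SpokeEdge t′ a b → t ≡ t′
    spokes-meet t∈S t′∈S (inj₁ (_ , e)) (inj₁ (_ , e′)) = spoke-unique t∈S t′∈S e e′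
    spokes-meet t∈S t′∈S (inj₂ (_ , e)) (inj₂ (_ , e′)) = spoke-unique t∈S t′∈S e e′
    spokes-meet t∈S t′∈S (inj₁ (_ , e)) (inj₂ (h , _))  = hub-clash (spoke∈W t∈S e) h
    spokes-meet t∈S t′∈S (inj₂ (_ , e)) (inj₁ (h , _))  = hub-clash (spoke∈W t∈S e) h

    routes-disjoint : ∀ {s t s′ t′} (e : Ends s t) (e′ : Ends s′ t′) {a b} →
                      Traverses (route e) a b → Traverses (route e′) a b →
                      (s ≡ s′ × t ≡ t′) ⊎ (s ≡ t′ × t ≡ s′)
    routes-disjoint (old p q r) (old p′ q′ r′) u v = disjoint I p q r p′ q′ r′ u v
    routes-disjoint (old p q r) (out t∈)       u v = old-vs-spoke (old-traverses p q r u) (outward-traverses t∈ v)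
    routes-disjoint (old p q r) (inn s∈)       u v = old-vs-spoke (old-traverses p q r u) (inward-traverses s∈ v)
    routes-disjoint (out t∈)    (old p q r)    u v = old-vs-spoke (old-traverses p q r v) (outward-traverses t∈ u)
    routes-disjoint (inn s∈)    (old p q r)    u v = old-vs-spoke (old-traverses p q r v) (inward-traverses s∈ u)
    routes-disjoint (out t∈)    (out t′∈)      u v =
      inj₁ (refl , spokes-meet t∈ t′∈ (outward-traverses t∈ u) (outward-traverses t′∈ v))
    routes-disjoint (out t∈)    (inn s′∈)      u v =
      inj₂ (refl , spokes-meet t∈ s′∈ (outward-traverses t∈ u) (inward-traverses s′∈ v))
    routes-disjoint (inn s∈)    (out t′∈)      u v =
      inj₂ (spokes-meet s∈ t′∈ (inward-traverses s∈ u) (outward-traverses t′∈ v) , refl)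
    routes-disjoint (inn s∈)    (inn s′∈)      u v =
      inj₁ (spokes-meet s∈ s′∈ (inward-traverses s∈ u) (inward-traverses s′∈ v) , refl)

    extended : Immersed W⁺ S⁺
    extended = record
      { S⊆W       = λ v∈ → [ (λ v∈S → W⊆W⁺ (S⊆W I v∈S)) , (λ v≡x → subst (_∈ W⁺) (sym (⁅⁆-≡ v≡x)) x∈W⁺) ]′
                             (∪-case {p = S} {q = ⁅ x ⁆} v∈)
      ; path      = λ p q r → route (ends p q r)
      ; interior∈ = λ p q r → route-interior (ends p q r)
      ; disjoint  = λ p q r p′ q′ r′ → routes-disjoint (ends p q r) (ends p′ q′ r′) }

  -- `Q` supplies the intermediate vertices w. Earlier paths may already run through `Q`: every new
  -- edge contains x or y, which lie outside `W`, so only the number of elements of `Q` has to be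
  -- compared.
  extend : ∀ {W S x y} (Q : Subset n) → Immersed W S → y ∈ co x → x ∉ W → y ∉ W →
           (∀ {v} → v ∈ Q → v ∈ W × v ∉ S × v ∉ co x × v ∉ co y) → # (S ∩ co x) ≤ # Q →
           Immersed (W ∪ ⁅ x ⁆ ∪ ⁅ y ⁆) (S ∪ ⁅ x ⁆)
  extend {W} {S} {x} {y} Q I xy x∉W y∉W hQ le with matching (S ∩ co x) Q le
  ... | g , g∈ , g-inj = Extend.extended I xy x∉W y∉W g
          (λ v∈ → proj₁ (hQ (g∈ v∈))) (λ v∈ → proj₁ (proj₂ (hQ (g∈ v∈))))
          (λ v∈ → proj₁ (proj₂ (proj₂ (hQ (g∈ v∈))))) (λ v∈ → proj₂ (proj₂ (proj₂ (hQ (g∈ v∈))))) g-inj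

-- A certificate for linear arithmetic: the contradictory inequalities, each repeated as often as
-- its weight, are added up to a ≤ b, and the ring solver confirms that a exceeds b by 1 + k.
⊥-from-≤ : ∀ {a b} k → a ≤ b → a ≡ suc (b + k) → ⊥
⊥-from-≤ {a} {b} k a≤b eq = 1+n≰n (≤-trans (s≤s (m≤m+n b k)) (≤-trans (≤-reflexive (sym eq)) a≤b))

-- Deleting a pair of nonadjacent vertices

module Reduction {n : ℕ} (G : Graph n) (α : α≤ G 2) where
  open Independence2 G α

  infixl 8 _─_
  _─_ : Subset n → V → Subset n
  (W ─ x) v = W v ∧ not (⁅ x ⁆ v)

  ─-⊆ : ∀ {W x} → W ─ x ⊆ W
  ─-⊆ {W} {x} = ∩-⊆ˡ {p = W} {q = ∁ ⁅ x ⁆}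

  ∈-─ : ∀ {W x v} → v ∈ W → v ≢ x → v ∈ W ─ x
  ∈-─ {W} {x} {v} v∈W v≢x = ∈-∩ {p = W} {q = ∁ ⁅ x ⁆} v∈W (∉⇒∈∁ {p = ⁅ x ⁆} {v = v} (∉-⁅⁆ v≢x))

  ─-─-⊆ : ∀ {W x y} → W ─ x ─ y ⊆ W
  ─-─-⊆ {W} {x} {y} h = ─-⊆ {W = W} {x = x} (─-⊆ {W = W ─ x} {x = y} h)

  ─-∉ : ∀ {W x} → x ∉ W ─ x
  ─-∉ {W} {x} rewrite dec-true (x ≟ x) refl with W x
  ... | true  = refl
  ... | false = refl

  ⁅⁆-∈ : ∀ {p : Subset n} {x v} → x ∈ p → v ∈ ⁅ x ⁆ → v ∈ p
  ⁅⁆-∈ {p} x∈p h = subst (_∈ p) (sym (⁅⁆-≡ h)) x∈p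

  ⁅⁆-∉ : ∀ {p : Subset n} {x v} → x ∉ p → v ∈ ⁅ x ⁆ → v ∉ p
  ⁅⁆-∉ {p} x∉p h = subst (_∉ p) (sym (⁅⁆-≡ h)) x∉p

  size-─ : ∀ W x → # W ≤ # (W ─ x) + 1
  size-─ W x = subst (λ k → # W ≤ # (W ─ x) + k) (#-singleton x)
    (total-mono W [] (W ─ x) (⁅ x ⁆ ∷ []) λ v → taut (W v) (⁅ x ⁆ v))
    where
    taut : ∀ w a → bit w ≤ bit (w ∧ not a) + bit a
    taut = decided (all-Bool? λ w → all-Bool? λ a → _ ≤? _)

  size-─-─ : ∀ W x y {k} → # (W ─ x ─ y) ≤ k → # W ≤ k + 2
  size-─-─ W x y {k} le = begin
    # W                  ≤⟨ size-─ W x ⟩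
    # (W ─ x) + 1        ≤⟨ +-monoˡ-≤ 1 (size-─ (W ─ x) y) ⟩
    # (W ─ x ─ y) + 1 + 1 ≤⟨ +-monoˡ-≤ 1 (+-monoˡ-≤ 1 le) ⟩
    k + 1 + 1            ≡⟨ +-assoc k 1 1 ⟩
    k + 2                ∎
    where open ≤-Reasoning

  size-─-∈ : ∀ W {x} → x ∈ W → # (W ─ x) + 1 ≤ # W
  size-─-∈ W {x} x∈W = subst (λ k → # (W ─ x) + k ≤ # W) (#-singleton x)
    (total-mono (W ─ x) (⁅ x ⁆ ∷ []) W [] λ v → taut (W v) (⁅ x ⁆ v) (⁅⁆-∈ {p = W} x∈W))
    where
    taut : ∀ w a → (a ≡ true → w ≡ true) → bit (w ∧ not a) + bit a ≤ bit w
    taut = decided (all-Bool? λ w → all-Bool? λ a → (a Bool.≟ true ⇒? w Bool.≟ true) ⇒? _ ≤? _)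

  size-∪ : ∀ S {x} → x ∉ S → # S + 1 ≤ # (S ∪ ⁅ x ⁆)
  size-∪ S {x} x∉S = subst (λ k → # S + k ≤ # (S ∪ ⁅ x ⁆)) (#-singleton x)
    (total-mono S (⁅ x ⁆ ∷ []) (S ∪ ⁅ x ⁆) [] λ v → taut (S v) (⁅ x ⁆ v) (⁅⁆-∉ {p = S} x∉S))
    where
    taut : ∀ s a → (a ≡ true → s ≡ false) → bit s + bit a ≤ bit (s ∨ a)
    taut = decided (all-Bool? λ s → all-Bool? λ a → (a Bool.≟ true ⇒? s Bool.≟ false) ⇒? _ ≤? _)

  double-size-∪ : ∀ S {x} → x ∉ S → # S + # S + 2 ≤ # (S ∪ ⁅ x ⁆) + # (S ∪ ⁅ x ⁆)
  double-size-∪ S x∉S = ≤-trans (≤-reflexive (rearrange (# S))) (+-mono-≤ (size-∪ S x∉S) (size-∪ S x∉S))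
    where
    rearrange : ∀ s → s + s + 2 ≡ (s + 1) + (s + 1)
    rearrange = solve-∀

  -- Doubling replaces the ceiling: deleting two vertices and adding one branch vertex changes both
  -- sides of the inequality by two.
  Half : Subset n → Set
  Half W = ∃ λ S → Immersed W S × # W ≤ # S + # S

  clique-half : ∀ {W Q} → Q ⊆ W → Clique Q → # W ≤ # Q + # Q → Half W
  clique-half {Q = Q} Q⊆W cl le = Q , clique-immersed Q⊆W cl , le

  cover : ∀ {W} D E → (∀ {v} → v ∈ W → v ∈ D ⊎ v ∈ E) → Clique (W ∩ D) → Clique (W ∩ E) → Half W
  cover {W} D E W⊆ clD clE with ≤-total (# (W ∩ D)) (# (W ∩ E))
    | total-mono W [] (W ∩ D) (W ∩ E ∷ []) (λ v → taut (W v) (D v) (E v) W⊆)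
    where
    taut : ∀ w d e → (w ≡ true → d ≡ true ⊎ e ≡ true) → bit w ≤ bit (w ∧ d) + bit (w ∧ e)
    taut false _     _     _ = z≤n
    taut true  true  _     _ = s≤s z≤n
    taut true  false true  _ = s≤s z≤n
    taut true  false false h with h refl
    ... | inj₁ ()
    ... | inj₂ ()
  ... | inj₁ D≤E | W≤ = clique-half (∩-⊆ˡ {p = W} {q = E}) clE (≤-trans W≤ (+-monoˡ-≤ _ D≤E))
  ... | inj₂ E≤D | W≤ = clique-half (∩-⊆ˡ {p = W} {q = D}) clD (≤-trans W≤ (+-monoʳ-≤ _ E≤D))

  common : Subset n → V → V → Subset n
  common W x y = W ∩ ∁ (co x) ∩ ∁ (co y)

  ∈-common : ∀ {W x y v} → v ∈ W → v ∉ co x → v ∉ co y → v ∈ common W x y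
  ∈-common v∈W v∉x v∉y rewrite v∈W | v∉x | v∉y = refl

  common-∈ : ∀ {W x y v} → v ∈ common W x y → v ∈ W × v ∉ co x × v ∉ co y
  common-∈ {W} {x} {y} {v} h with W v | co x v | co y v
  ... | true | false | false = refl , refl , refl

  disjoint-neighbourhoods : ∀ {x y v} → y ∈ co x → v ∈ co x → v ∉ co y
  disjoint-neighbourhoods xy xv = co-triangle-free (co-sym xy) xv

  size≤ : ∀ W x y → # W ≤ # (W ∩ co y) + (# (W ∩ co x) + # (common W x y))
  size≤ W x y = total-mono W [] (W ∩ co y) (W ∩ co x ∷ common W x y ∷ []) λ v → taut (W v) (co x v) (co y v)
    where
    taut : ∀ w p q → bit w ≤ bit (w ∧ q) + (bit (w ∧ p) + bit (w ∧ not p ∧ not q))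
    taut = decided (all-Bool? λ w → all-Bool? λ p → all-Bool? λ q → _ ≤? _)

  size≥ : ∀ W {x y} → y ∈ co x → # (W ∩ co y) + (# (W ∩ co x) + # (common W x y)) ≤ # W
  size≥ W {x} {y} xy = total-mono (W ∩ co y) (W ∩ co x ∷ common W x y ∷ []) W []
      λ v → taut (W v) (co x v) (co y v) (disjoint-neighbourhoods xy)
    where
    taut : ∀ w p q → (p ≡ true → q ≡ false) → bit (w ∧ q) + (bit (w ∧ p) + bit (w ∧ not p ∧ not q)) ≤ bit w
    taut = decided (all-Bool? λ w → all-Bool? λ p → all-Bool? λ q →
                       (p Bool.≟ true ⇒? q Bool.≟ false) ⇒? _ ≤? _)

  common-swap : ∀ W x y → # (common W x y) ≤ # (common W y x)
  common-swap W x y = total-mono (common W x y) [] (common W y x) [] λ v → taut (W v) (co x v) (co y v)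
    where
    taut : ∀ w p q → bit (w ∧ not p ∧ not q) ≤ bit (w ∧ not q ∧ not p)
    taut = decided (all-Bool? λ w → all-Bool? λ p → all-Bool? λ q → _ ≤? _)

  Balanced : Subset n → V → V → Set
  Balanced W x y = # (W ∩ co y) + # (W ∩ co x) ≤ # (common W x y) + 4

  private
    -- The last hypothesis is |S ∩ N(x)| ≤ |B ∖ S| with the subtraction cleared; the vertices of B
    -- outside `S` become the intermediate vertices.
    attach : ∀ {W S x y} → x ∈ W → y ∈ W → y ∈ co x → Immersed (W ─ x ─ y) S → # (W ─ x ─ y) ≤ # S + # S →
             # (S ∩ co x) + # (S ∩ common W x y) ≤ # (common W x y) → Half W
    attach {W} {S} {x} {y} x∈W y∈W xy I W′≤ room =
      S ∪ ⁅ x ⁆ , immersed-mono W⁺⊆W (extend Q I xy x∉W′ y∉W′ Q-free room′) , W≤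
      where
      W′ Q : Subset n
      W′ = W ─ x ─ y
      Q  = common W x y ∩ ∁ S

      y∉W′ : y ∉ W′
      y∉W′ = ─-∉ {W = W ─ x}

      x∉W′ : x ∉ W′
      x∉W′ = ∉-⊆ {p = W′} {q = W ─ x} (─-⊆ {W = W ─ x} {x = y}) (─-∉ {W = W} {x = x})

      x∉S : x ∉ S
      x∉S = ∉-⊆ {p = S} {q = W′} (Immersed.S⊆W I) x∉W′

      Q-free : ∀ {v} → v ∈ Q → v ∈ W′ × v ∉ S × v ∉ co x × v ∉ co y
      Q-free {v} v∈Q with common-∈ {W = W} {x} {y} (∩-⊆ˡ {p = common W x y} {q = ∁ S} v∈Q)
      -- `common W x y` contains neither x nor y, each being a co-neighbour of the other, so its
      -- elements survive the deletion.
      ... | v∈W , v∉x , v∉y =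
        ∈-─ {W = W ─ x} (∈-─ {W = W} v∈W (≢-sym (∉⇒≢ {p = co y} (co-sym xy) v∉y))) (≢-sym (∉⇒≢ {p = co x} xy v∉x))
        , ∈∁⇒∉ {p = S} (∩-⊆ʳ {p = common W x y} {q = ∁ S} v∈Q) , v∉x , v∉y

      split : # (common W x y) ≤ # (S ∩ common W x y) + # Q
      split = total-mono (common W x y) [] (S ∩ common W x y) (Q ∷ []) λ v → taut (common W x y v) (S v)
        where
        taut : ∀ b s → bit b ≤ bit (s ∧ b) + bit (b ∧ not s)
        taut = decided (all-Bool? λ b → all-Bool? λ s → _ ≤? _)

      room′ : # (S ∩ co x) ≤ # Q
      room′ = +-cancelˡ-≤ (# (S ∩ common W x y)) _ _
                (≤-trans (≤-reflexive (+-comm (# (S ∩ common W x y)) _)) (≤-trans room split))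

      W⁺⊆W : W′ ∪ ⁅ x ⁆ ∪ ⁅ y ⁆ ⊆ W
      W⁺⊆W {v} v∈ with ∪-case {p = W′} {q = ⁅ x ⁆ ∪ ⁅ y ⁆} {v = v} v∈
      ... | inj₁ v∈W′ = ─-─-⊆ {W} {x} {y} v∈W′
      ... | inj₂ v∈xy with ∪-case {p = ⁅ x ⁆} {q = ⁅ y ⁆} {v = v} v∈xy
      ...   | inj₁ v≡x = ⁅⁆-∈ {p = W} x∈W v≡x
      ...   | inj₂ v≡y = ⁅⁆-∈ {p = W} y∈W v≡y

      W≤ : # W ≤ # (S ∪ ⁅ x ⁆) + # (S ∪ ⁅ x ⁆)
      W≤ = ≤-trans (size-─-─ W x y W′≤) (double-size-∪ S x∉S)

    -- Here a, c, b count `S` in N(y), N(x) and B, and β bounds b as |B|. Adding the two failures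
    -- gives 2β + 2 ≤ a + c + 2b ≤ s + β, so s ≥ β + 2, and then w ≤ p + q + β ≤ 2β + 4 ≤ 2s. This
    -- is the origin of the 4 in `Balanced`.
    crowded : ∀ {a b c s w β p q} → suc β ≤ c + b → suc β ≤ a + b → a + (c + b) ≤ s → b ≤ β →
              suc (s + s) ≤ w → w ≤ p + (q + β) → p + q ≤ β + 4 → ⊥
    crowded {a} {b} {c} {s} {w} {β} {p} {q} h₁ h₂ h₃ h₄ h₅ h₆ h₇ =
      ⊥-from-≤ 0 (+-mono-≤ (+-mono-≤ (+-mono-≤ h₁ h₂) (+-mono-≤ h₁ h₂))
                   (+-mono-≤ (+-mono-≤ (+-mono-≤ h₃ h₄) (+-mono-≤ h₃ h₄)) (+-mono-≤ h₅ (+-mono-≤ h₆ h₇))))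
                 (eq a b c s w β p q)
      where
      eq : ∀ a b c s w β p q →
           ((suc β + suc β) + (suc β + suc β)) +
             ((((a + (c + b)) + b) + ((a + (c + b)) + b)) + (suc (s + s) + (w + (p + q))))
           ≡ suc (((((c + b) + (a + b)) + ((c + b) + (a + b))) +
             (((s + β) + (s + β)) + (w + ((p + (q + β)) + (β + 4))))) + 0)
      eq = solve-∀

  -- If neither x nor y can be attached to the branch set S of W ─ x ─ y, then S has more than
  -- # (common W x y) + 1 elements, which is at least half of W by balance.
  balanced-step : ∀ {W x y} → x ∈ W → y ∈ W → y ∈ co x → Balanced W x y → Half (W ─ x ─ y) → Half W
  balanced-step {W} {x} {y} x∈W y∈W xy bal (S , I , W′≤) with # W ≤? # S + # S
  ... | yes W≤ = S , immersed-mono (─-─-⊆ {W} {x} {y}) I , W≤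
  ... | no W≰ with # (S ∩ co x) + # (S ∩ common W x y) ≤? # (common W x y)
                 | # (S ∩ co y) + # (S ∩ common W x y) ≤? # (common W x y)
  ...   | yes room | _ = attach x∈W y∈W xy I W′≤ room
  ...   | no _ | yes room = attach y∈W x∈W (co-sym xy) (immersed-mono swap⊆ I) (≤-trans swap≤ W′≤)
                              (≤-trans (+-monoʳ-≤ (# (S ∩ co y)) S-swap) (≤-trans room (common-swap W x y)))
    where
    swap⊆ : W ─ x ─ y ⊆ W ─ y ─ x
    swap⊆ {v} h with W v | ⁅ x ⁆ v | ⁅ y ⁆ v
    ... | true | false | false = refl
    swap≤ : # (W ─ y ─ x) ≤ # (W ─ x ─ y)
    swap≤ = total-mono (W ─ y ─ x) [] (W ─ x ─ y) [] λ v → taut (W v) (⁅ x ⁆ v) (⁅ y ⁆ v)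
      where
      taut : ∀ w p q → bit ((w ∧ not q) ∧ not p) ≤ bit ((w ∧ not p) ∧ not q)
      taut = decided (all-Bool? λ w → all-Bool? λ p → all-Bool? λ q → _ ≤? _)
    S-swap : # (S ∩ common W y x) ≤ # (S ∩ common W x y)
    S-swap = total-mono (S ∩ common W y x) [] (S ∩ common W x y) [] λ v → taut (S v) (W v) (co x v) (co y v)
      where
      taut : ∀ s w p q → bit (s ∧ w ∧ not q ∧ not p) ≤ bit (s ∧ w ∧ not p ∧ not q)
      taut = decided (all-Bool? λ s → all-Bool? λ w → all-Bool? λ p → all-Bool? λ q → _ ≤? _)
  ...   | no ¬room | no ¬room′ =
    ⊥-elim (crowded {b = # (S ∩ common W x y)} {p = # (W ∩ co y)}
                    (≰⇒> ¬room) (≰⇒> ¬room′) parts common≤ (≰⇒> W≰) (size≤ W x y) bal)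
    where
    parts : # (S ∩ co y) + (# (S ∩ co x) + # (S ∩ common W x y)) ≤ # S
    parts = total-mono (S ∩ co y) (S ∩ co x ∷ S ∩ common W x y ∷ []) S []
              λ v → taut (S v) (W v) (co x v) (co y v) (disjoint-neighbourhoods xy)
      where
      taut : ∀ s w p q → (p ≡ true → q ≡ false) →
             bit (s ∧ q) + (bit (s ∧ p) + bit (s ∧ w ∧ not p ∧ not q)) ≤ bit s
      taut = decided (all-Bool? λ s → all-Bool? λ w → all-Bool? λ p → all-Bool? λ q →
                         (p Bool.≟ true ⇒? q Bool.≟ false) ⇒? _ ≤? _)
    common≤ : # (S ∩ common W x y) ≤ # (common W x y)
    common≤ = total-mono (S ∩ common W x y) [] (common W x y) [] λ v → taut (S v) (common W x y v)
      where
      taut : ∀ s b → bit (s ∧ b) ≤ bit b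
      taut = decided (all-Bool? λ s → all-Bool? λ b → _ ≤? _)

  -- The step may recurse on any co-edge of `W`, not just on the given one: `4K₁-half` has to change
  -- the pair when x y is unbalanced.
  pair-induction : (P : Subset n → Set) → (∀ {W} → Clique W → P W) →
    (∀ {W x y} → x ∈ W → y ∈ W → y ∈ co x →
       (∀ {u v} → u ∈ W → v ∈ W → v ∈ co u → P (W ─ u ─ v)) → P W) →
    ∀ W → P W
  pair-induction P base step W = go (# W) W ≤-refl
    where
    go : ∀ k W → # W ≤ k → P W
    go k W W≤k with any? (λ x → any? (λ y → (W x Bool.≟ true) ×-dec (W y Bool.≟ true) ×-dec (co x y Bool.≟ true)))
    ... | no ¬p = base λ {u} {v} u∈W v∈W → ¬-not λ uv → ¬p (u , v , u∈W , v∈W , uv)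
    ... | yes (x , y , x∈W , y∈W , xy) with k
    ...   | zero  = ⊥-elim (n≮0 (≤-trans (≤-reflexive (+-comm 1 _)) (≤-trans (size-─-∈ W x∈W) W≤k)))
    ...   | suc k = step x∈W y∈W xy λ {u} {v} u∈W v∈W uv → go k (W ─ u ─ v)
              (+-cancelʳ-≤ 1 _ _ (begin
                # (W ─ u ─ v) + 1  ≤⟨ size-─-∈ (W ─ u) (∈-─ {W = W} v∈W (≢-sym (co⇒≢ uv))) ⟩
                # (W ─ u)          ≤⟨ m≤m+n _ 1 ⟩
                # (W ─ u) + 1      ≤⟨ size-─-∈ W u∈W ⟩
                # W                ≤⟨ W≤k ⟩
                suc k              ≡⟨ +-comm 1 k ⟩
                k + 1              ∎))
      where open ≤-Reasoning

  neighbourhood-clique : ∀ {y u v} → u ∈ co y → v ∈ co y → v ∉ co u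
  neighbourhood-clique yu yv = co-triangle-free (co-sym yu) yv

-- Excluded subgraphs of the complement

module Patterns {n : ℕ} (G : Graph n) (α : α≤ G 2) where
  open Independence2 G α
  open Reduction G α

  three-elements : ∀ {p : Subset n} → 3 ≤ # p → ∃ λ u → ∃ λ v → ∃ λ w → (u ∈ p × v ∈ p × w ∈ p) × u ≢ v × u ≢ w × v ≢ w
  three-elements {p} le with choose p 3 le
  ... | e , e∈ , distinct = e zero , e (suc zero) , e (suc (suc zero)) , (e∈ _ , e∈ _ , e∈ _) ,
        distinct (λ ()) , distinct (λ ()) , distinct (λ ())

  no-co-edge-half : ∀ W → Clique W → Half W
  no-co-edge-half W cl = clique-half {W = W} (λ h → h) cl (m≤m+n _ _)

  small-balanced : ∀ {W x y} → # (W ∩ co y) ≤ 2 → # (W ∩ co x) ≤ 2 → Balanced W x y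
  small-balanced h h′ = ≤-trans (+-mono-≤ h h′) (m≤n+m 4 _)

  trace-clique : ∀ W x → Clique (W ∩ co x)
  trace-clique W x u∈ v∈ = neighbourhood-clique (∩-⊆ʳ {p = W} {q = co x} u∈) (∩-⊆ʳ {p = W} {q = co x} v∈)

  bipartite-half : ∀ {W x y} → (∀ {v} → v ∉ common W x y) → Half W
  bipartite-half {W} {x} {y} empty = cover (co x) (co y) split
      (trace-clique W x) (trace-clique W y)
    where
    split : ∀ {v} → v ∈ W → v ∈ co x ⊎ v ∈ co y
    split {v} v∈W with co x v in eqx | co y v in eqy
    ... | true  | _     = inj₁ refl
    ... | false | true  = inj₂ refl
    ... | false | false = ⊥-elim (∈-∉ {p = common W x y} (∈-common {W = W} v∈W eqx eqy) empty)

  -- The excluded patterns, read in the complement. Relations that triangle-freeness supplies are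
  -- left out: co-neighbours of one vertex, and with them the diagonals of a square or vertices two
  -- apart on a path, are never joined in `co`.
  NoStar : Set
  NoStar = ∀ {c p q r} → p ∈ co c → q ∈ co c → r ∈ co c → p ≢ q → p ≢ r → q ≢ r → ⊥

  NoSquare : Set
  NoSquare = ∀ {p q r s} → q ∈ co p → r ∈ co q → s ∈ co r → s ∈ co p → p ≢ r → q ≢ s → ⊥

  NoEdge+2K₁ : Set
  NoEdge+2K₁ = ∀ {u v x a} → v ∈ co u → x ≢ a → a ∉ co x → u ∉ co x → v ∉ co x → u ∉ co a → v ∉ co a → ⊥

  NoP₃+K₁ : Set
  NoP₃+K₁ = ∀ {p q r s} → q ∈ co p → r ∈ co q → p ≢ r → p ∉ co s → q ∉ co s → r ∉ co s → ⊥

  NoP₄ : Set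
  NoP₄ = ∀ {p q r s} → q ∈ co p → r ∈ co q → s ∈ co r → s ∉ co p → ⊥

  No4K₁ : Set
  No4K₁ = ∀ {p q r s} → p ≢ q → p ≢ r → p ≢ s → q ≢ r → q ≢ s → r ≢ s →
          q ∉ co p → r ∉ co p → s ∉ co p → r ∉ co q → s ∉ co q → s ∉ co r → ⊥

  -- Without a star the degrees in `co` are at most 2, and 2 + 2 ≤ |B| + 4 makes every co-edge
  -- balanced.
  star-half : NoStar → ∀ W → Half W
  star-half noStar = pair-induction Half (λ {W} → no-co-edge-half W) λ {W} x∈W y∈W xy ih →
      balanced-step x∈W y∈W xy (small-balanced {W} (degree≤2 W _) (degree≤2 W _)) (ih x∈W y∈W xy)
    where
    degree≤2 : ∀ W x → # (W ∩ co x) ≤ 2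
    degree≤2 W x with # (W ∩ co x) ≤? 2
    ... | yes le = le
    ... | no  gt with three-elements {p = W ∩ co x} (≰⇒> gt)
    ... | u , v , w , (u∈ , v∈ , w∈) , u≢v , u≢w , v≢w =
      ⊥-elim (noStar (∩-⊆ʳ {p = W} {co x} u∈) (∩-⊆ʳ {p = W} {co x} v∈) (∩-⊆ʳ {p = W} {co x} w∈) u≢v u≢w v≢w)

  -- Without 4-cycles no co-edge joins N(x) ∖ {y} to N(y) ∖ {x}, so their union is a clique `Q` of
  -- size |N(x)| + |N(y)| - 2. If xy is unbalanced, then |W| ≤ 2(|N(x)| + |N(y)|) - 5 < 2|Q|.
  square-half : NoSquare → ∀ W → Half W
  square-half noSquare = pair-induction Half (λ {W} → no-co-edge-half W) step
    where
    step : ∀ {W x y} → x ∈ W → y ∈ W → y ∈ co x →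
           (∀ {u v} → u ∈ W → v ∈ W → v ∈ co u → Half (W ─ u ─ v)) → Half W
    step {W} {x} {y} x∈W y∈W xy ih with # (W ∩ co y) + # (W ∩ co x) ≤? # (common W x y) + 4
    ... | yes bal = balanced-step x∈W y∈W xy bal (ih x∈W y∈W xy)
    ... | no ¬bal = clique-half {W} {Q} Q⊆W Q-clique
                      (+-cancelʳ-≤ 4 _ _ (counting (# W) (# (W ∩ co y)) _ _ _ (≰⇒> ¬bal) (size≤ W x y) Q-size))
      where
      Q : Subset n
      Q = W ∩ (co y ∪ co x) ∩ ∁ ⁅ x ⁆ ∩ ∁ ⁅ y ⁆

      Q-∈ : ∀ {v} → v ∈ Q → v ∈ W × (v ∈ co y ⊎ v ∈ co x) × v ≢ x × v ≢ y
      Q-∈ {v} h with W v | co y v | co x v | v ≟ x | v ≟ y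
      ... | true | true  | _    | no v≢x | no v≢y = refl , inj₁ refl , v≢x , v≢y
      ... | true | false | true | no v≢x | no v≢y = refl , inj₂ refl , v≢x , v≢y

      Q⊆W : Q ⊆ W
      Q⊆W h = proj₁ (Q-∈ h)

      Q-clique : Clique Q
      Q-clique u∈ v∈ with Q-∈ u∈ | Q-∈ v∈
      ... | _ , inj₁ yu , _ | _ , inj₁ yv , _ = neighbourhood-clique yu yv
      ... | _ , inj₂ xu , _ | _ , inj₂ xv , _ = neighbourhood-clique xu xv
      ... | _ , inj₁ yu , u≢x , _ | _ , inj₂ xv , _ , v≢y =
        ¬-not λ uv → noSquare xy yu uv xv (≢-sym u≢x) (≢-sym v≢y)
      ... | _ , inj₂ xu , _ , u≢y | _ , inj₁ yv , v≢x , _ =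
        ¬-not λ uv → noSquare xy yv (co-sym uv) xu (≢-sym v≢x) (≢-sym u≢y)

      Q-size : # (W ∩ co y) + # (W ∩ co x) ≤ # Q + 2
      Q-size = subst (λ k → # (W ∩ co y) + # (W ∩ co x) ≤ # Q + k) (cong₂ _+_ (#-singleton x) (#-singleton y))
        (total-mono (W ∩ co y) (W ∩ co x ∷ []) Q (⁅ x ⁆ ∷ ⁅ y ⁆ ∷ [])
          λ v → taut (W v) (co x v) (co y v) (⁅ x ⁆ v) (⁅ y ⁆ v) (disjoint-neighbourhoods xy))
        where
        taut : ∀ w p q a b → (p ≡ true → q ≡ false) →
               bit (w ∧ q) + bit (w ∧ p) ≤ bit (w ∧ (q ∨ p) ∧ not a ∧ not b) + (bit a + bit b)
        taut = decided (all-Bool? λ w → all-Bool? λ p → all-Bool? λ q → all-Bool? λ a → all-Bool? λ b →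
                          (p Bool.≟ true ⇒? q Bool.≟ false) ⇒? _ ≤? _)

      counting : ∀ w p q β k → suc (β + 4) ≤ p + q → w ≤ p + (q + β) → p + q ≤ k + 2 → w + 4 ≤ k + k + 4
      counting w p q β k h₁ h₂ h₃ with w + 4 ≤? k + k + 4
      ... | yes le = le
      ... | no  gt = ⊥-elim (⊥-from-≤ 1 (+-mono-≤ (+-mono-≤ h₁ h₂) (+-mono-≤ (+-mono-≤ h₃ h₃) (≰⇒> gt))) (eq w p q β k))
        where
        eq : ∀ w p q β k → (suc (β + 4) + w) + (((p + q) + (p + q)) + suc (k + k + 4)) ≡
                           suc (((p + q) + (p + (q + β))) + (((k + 2) + (k + 2)) + (w + 4)) + 1)
        eq = solve-∀

  -- A 4-cycle x y a c in the complement splits G into the two cliques missed by {x , a} and by {y , c}.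
  edge+2K₁-half : NoEdge+2K₁ → ∀ W → Half W
  edge+2K₁-half noEdge W
    with any? (λ x → any? λ y → any? λ a → any? λ c →
           (co x y Bool.≟ true) ×-dec (co y a Bool.≟ true) ×-dec (co a c Bool.≟ true) ×-dec (co x c Bool.≟ true)
             ×-dec ¬? (x ≟ a) ×-dec ¬? (y ≟ c))
  ... | no ¬square = square-half (λ {p} {q} {r} {s} pq qr rs ps p≢r q≢s →
                       ¬square (p , q , r , s , pq , qr , rs , ps , p≢r , q≢s)) W
  ... | yes (x , y , a , c , xy , ya , ac , xc , x≢a , y≢c) = cover (missed x a) (missed y c) split
          (missed-clique x≢a (neighbourhood-clique (co-sym xy) ya))
          (missed-clique y≢c (neighbourhood-clique xy xc))
    where
    missed : V → V → Subset n
    missed u v = ∁ (co u) ∩ ∁ (co v)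

    missed-clique : ∀ {u v} → u ≢ v → v ∉ co u → Clique (W ∩ missed u v)
    missed-clique {u} {v} u≢v uv {s} {t} s∈ t∈ with W s | W t | co u s in us | co v s in vs | co u t in ut | co v t in vt
    ... | true | true | false | false | false | false = ¬-not λ st → noEdge st u≢v uv us ut vs vt

    split : ∀ {v} → v ∈ W → v ∈ missed x a ⊎ v ∈ missed y c
    split {v} _ with co x v in xv | co a v in av | co y v in yv | co c v in cv
    ... | false | false | _     | _     = inj₁ refl
    ... | _     | _     | false | false = inj₂ refl
    ... | true  | _     | true  | _     = ⊥-elim (no-triangle xy yv xv)
    ... | true  | _     | _     | true  = ⊥-elim (no-triangle xc cv xv)
    ... | _     | true  | true  | _     = ⊥-elim (no-triangle ya av yv)
    ... | _     | true  | _     | true  = ⊥-elim (no-triangle ac cv av)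

  -- If B contains some b, then every a ≠ x in N(y) is a co-neighbour of b, as otherwise x - y - a
  -- and b form P₃ + K₁. Two such vertices a, a′ would give a path a - b - a′ missed by x. Hence
  -- |N(y)| ≤ 2, likewise |N(x)| ≤ 2, and the co-edge is balanced. With B empty, the cliques N(x)
  -- and N(y) cover `W`.
  P₃+K₁-half : NoP₃+K₁ → ∀ W → Half W
  P₃+K₁-half noP₃ = pair-induction Half (λ {W} → no-co-edge-half W) step
    where
    degree≤2 : ∀ {W x y b} → y ∈ co x → b ∈ common W x y → # (W ∩ co y) ≤ 2
    degree≤2 {W} {x} {y} {b} xy b∈ with # (W ∩ co y) ≤? 2
    ... | yes le = le
    ... | no  gt with three-elements {p = W ∩ co y} (≰⇒> gt) | common-∈ {W = W} {x} {y} b∈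
    ... | u , v , w , (u∈ , v∈ , w∈) , u≢v , u≢w , v≢w | _ , xb , yb = ⊥-elim (pick-two (u ≟ x) (v ≟ x))
      where
      missed-by-b : ∀ {a} → a ∈ co y → a ≢ x → a ∈ co b
      missed-by-b {a} ya a≢x with co b a in ba
      ... | true  = refl
      ... | false = ⊥-elim (noP₃ xy ya (≢-sym a≢x) (¬co-sym xb) (¬co-sym yb) ba)

      two : ∀ {a a′} → a ∈ W ∩ co y → a′ ∈ W ∩ co y → a ≢ x → a′ ≢ x → a ≢ a′ → ⊥
      two a∈ a′∈ a≢x a′≢x a≢a′ = noP₃ (co-sym (missed-by-b ya a≢x)) (missed-by-b ya′ a′≢x) a≢a′
          (neighbourhood-clique (co-sym xy) ya) xb (neighbourhood-clique (co-sym xy) ya′)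
        where
        ya  = ∩-⊆ʳ {p = W} {q = co y} a∈
        ya′ = ∩-⊆ʳ {p = W} {q = co y} a′∈

      pick-two : Dec (u ≡ x) → Dec (v ≡ x) → ⊥
      pick-two (yes refl) _          = two v∈ w∈ (≢-sym u≢v) (≢-sym u≢w) v≢w
      pick-two (no u≢x)   (yes refl) = two u∈ w∈ u≢x (≢-sym v≢w) u≢w
      pick-two (no u≢x)   (no v≢x)   = two u∈ v∈ u≢x v≢x u≢v

    step : ∀ {W x y} → x ∈ W → y ∈ W → y ∈ co x →
           (∀ {u v} → u ∈ W → v ∈ W → v ∈ co u → Half (W ─ u ─ v)) → Half W
    step {W} {x} {y} x∈W y∈W xy ih with any? (λ b → common W x y b Bool.≟ true)
    ... | no empty = bipartite-half {W} {x} {y} (λ {v} → ¬-not λ b∈ → empty (v , b∈))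
    ... | yes (b , b∈) with common-∈ {W = W} {x} {y} b∈
    ...   | b∈W , xb , yb = balanced-step x∈W y∈W xy
              (small-balanced {W} (degree≤2 {W} xy b∈) (degree≤2 {W} (co-sym xy) (∈-common {W = W} b∈W yb xb))) (ih x∈W y∈W xy)

  -- If x and y had co-neighbours c and v in the clique, then v - y - x - c would be an induced path
  -- of `co`. So one of x and y extends the clique itself, without any detour.
  P₄-half : NoP₄ → ∀ W → Half W
  P₄-half noP₄ W = let S , S⊆W , cl , W≤ = pair-induction CliqueHalf base step W in clique-half S⊆W cl W≤
    where
    CliqueHalf : Subset n → Set
    CliqueHalf W = ∃ λ S → (S ⊆ W) × Clique S × # W ≤ # S + # S

    base : ∀ {W} → Clique W → CliqueHalf W
    base {W} cl = W , (λ h → h) , cl , m≤m+n _ _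

    add : ∀ {W S x} → x ∈ W → S ⊆ W → x ∉ S → Clique S → (∀ {v} → v ∈ S → v ∉ co x) →
          # W ≤ # S + # S + 2 → CliqueHalf W
    add {W} {S} {x} x∈W S⊆W x∉S cl free le = S ∪ ⁅ x ⁆ , S⁺⊆W , cl⁺ , ≤-trans le (double-size-∪ S x∉S)
      where
      S⁺⊆W : S ∪ ⁅ x ⁆ ⊆ W
      S⁺⊆W {v} v∈ = [ S⊆W , ⁅⁆-∈ {p = W} x∈W ]′ (∪-case {p = S} {q = ⁅ x ⁆} {v = v} v∈)

      cl⁺ : Clique (S ∪ ⁅ x ⁆)
      cl⁺ {u} {v} u∈ v∈ with ∪-case {p = S} {q = ⁅ x ⁆} {v = u} u∈ | ∪-case {p = S} {q = ⁅ x ⁆} {v = v} v∈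
      ... | inj₁ u∈S | inj₁ v∈S = cl u∈S v∈S
      ... | inj₁ u∈S | inj₂ v≡x rewrite ⁅⁆-≡ {x = x} {v = v} v≡x = ¬co-sym (free u∈S)
      ... | inj₂ u≡x | inj₁ v∈S rewrite ⁅⁆-≡ {x = x} {v = u} u≡x = free v∈S
      ... | inj₂ u≡x | inj₂ v≡x rewrite ⁅⁆-≡ {x = x} {v = u} u≡x | ⁅⁆-≡ {x = x} {v = v} v≡x = co-irrefl x

    step : ∀ {W x y} → x ∈ W → y ∈ W → y ∈ co x →
           (∀ {u v} → u ∈ W → v ∈ W → v ∈ co u → CliqueHalf (W ─ u ─ v)) → CliqueHalf W
    step {W} {x} {y} x∈W y∈W xy ih with ih x∈W y∈W xy
    ... | S , S⊆W′ , cl , W′≤ = grow (any? (λ v → (S v Bool.≟ true) ×-dec (co x v Bool.≟ true)))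
      where
      S⊆W : S ⊆ W
      S⊆W h = ─-─-⊆ {W} {x} {y} (S⊆W′ h)

      x∉S : x ∉ S
      x∉S = ∉-⊆ {p = S} {q = W ─ x} (λ h → ─-⊆ {W = W ─ x} {x = y} (S⊆W′ h)) (─-∉ {W = W})

      y∉S : y ∉ S
      y∉S = ∉-⊆ {p = S} {q = W ─ x ─ y} S⊆W′ (─-∉ {W = W ─ x})

      W≤ : # W ≤ # S + # S + 2
      W≤ = size-─-─ W x y W′≤

      grow : Dec (∃ λ v → v ∈ S × v ∈ co x) → CliqueHalf W
      grow (no ¬c)              = add x∈W S⊆W x∉S cl (λ {v} v∈S → ¬-not λ xv → ¬c (v , v∈S , xv)) W≤
      grow (yes (c , c∈S , xc)) = add y∈W S⊆W y∉S cl (λ v∈S → ¬-not λ yv → noP₄ (co-sym yv) (co-sym xy) xc (cl v∈S c∈S)) W≤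

  -- Cliques of G have at most 3 vertices, so degrees in `co` are at most 3. An unbalanced co-edge
  -- with B nonempty has |B| + 5 ≤ |N(x)| + |N(y)| ≤ 6, which leaves |B| = 1, both degrees 3 and |W|
  -- = 7. A co-edge with an end of degree at most 2 is then found at or next to the single vertex b
  -- of B.
  4K₁-half : No4K₁ → ∀ W → Half W
  4K₁-half no4K₁ = pair-induction Half (λ {W} → no-co-edge-half W) step
    where
    clique≤3 : ∀ Q → Clique Q → # Q ≤ 3
    clique≤3 Q cl with # Q ≤? 3
    ... | yes le = le
    ... | no  gt with choose Q 4 (≰⇒> gt)
    ... | e , e∈ , distinct = ⊥-elim (no4K₁ (distinct λ ()) (distinct λ ()) (distinct λ ()) (distinct λ ()) (distinct λ ()) (distinct λ ())
            (cl (e∈ v₀) (e∈ v₁)) (cl (e∈ v₀) (e∈ v₂)) (cl (e∈ v₀) (e∈ v₃))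
            (cl (e∈ v₁) (e∈ v₂)) (cl (e∈ v₁) (e∈ v₃)) (cl (e∈ v₂) (e∈ v₃)))
      where
      v₀ v₁ v₂ v₃ : Fin 4
      v₀ = zero
      v₁ = suc zero
      v₂ = suc (suc zero)
      v₃ = suc (suc (suc zero))

    degree≤3 : ∀ W x → # (W ∩ co x) ≤ 3
    degree≤3 W x = clique≤3 (W ∩ co x) (trace-clique W x)

    -- |B| ≥ 7 - 3 - 2 = 2, hence |N(x)| + |N(y)| ≤ 5 < |B| + 4.
    low-degree-balanced : ∀ {W x y} → 7 ≤ # W → # (W ∩ co x) ≤ 2 → Balanced W x y
    low-degree-balanced {W} {x} {y} big low =
      arith (# W) (# (W ∩ co y)) (# (W ∩ co x)) (# (common W x y)) big (size≤ W x y) (degree≤3 W y) low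
      where
      arith : ∀ w p q β → 7 ≤ w → w ≤ p + (q + β) → p ≤ 3 → q ≤ 2 → p + q ≤ β + 4
      arith w p q β h₁ h₂ h₃ h₄ with p + q ≤? β + 4
      ... | yes le = le
      ... | no  gt = ⊥-elim (⊥-from-≤ 1 (+-mono-≤ (+-mono-≤ h₁ h₂) (+-mono-≤ (+-mono-≤ h₃ h₄)
                       (+-mono-≤ (+-mono-≤ h₃ h₄) (≰⇒> gt)))) (eq w p q β))
        where
        eq : ∀ w p q β → (7 + w) + ((p + q) + ((p + q) + suc (β + 4))) ≡
                         suc ((w + (p + (q + β))) + ((3 + 2) + ((3 + 2) + (p + q))) + 1)
        eq = solve-∀

    -- In the complement, two of the at most three neighbours of y are joined to b, hence not to c.
    low-degree : ∀ {W x y b c} → c ∈ co x → c ∈ co b → # (W ∩ co y) ≤ 3 → # (common W x y) ≤ 1 →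
                 2 ≤ # (W ∩ co b ∩ co y) → # (W ∩ co c) ≤ 2
    low-degree {W} {x} {y} {b} {c} xc bc h₁ h₂ h₃ =
      +-cancelʳ-≤ 2 _ _ (≤-trans (+-monoʳ-≤ (# (W ∩ co c)) h₃) (≤-trans count (+-mono-≤ h₁ h₂)))
      where
      count : # (W ∩ co c) + # (W ∩ co b ∩ co y) ≤ # (W ∩ co y) + # (common W x y)
      count = total-mono (W ∩ co c) (W ∩ co b ∩ co y ∷ []) (W ∩ co y) (common W x y ∷ [])
          λ v → taut (W v) (co x v) (co y v) (co b v) (co c v)
                     (disjoint-neighbourhoods (co-sym bc)) (disjoint-neighbourhoods (co-sym xc))
        where
        taut : ∀ w p q r s → (s ≡ true → r ≡ false) → (s ≡ true → p ≡ false) →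
               bit (w ∧ s) + bit (w ∧ r ∧ q) ≤ bit (w ∧ q) + bit (w ∧ not p ∧ not q)
        taut = decided (all-Bool? λ w → all-Bool? λ p → all-Bool? λ q → all-Bool? λ r → all-Bool? λ s →
                 (s Bool.≟ true ⇒? r Bool.≟ false) ⇒? (s Bool.≟ true ⇒? p Bool.≟ false) ⇒? _ ≤? _)

    step : ∀ {W x y} → x ∈ W → y ∈ W → y ∈ co x →
           (∀ {u v} → u ∈ W → v ∈ W → v ∈ co u → Half (W ─ u ─ v)) → Half W
    step {W} {x} {y} x∈W y∈W xy ih with # (W ∩ co y) + # (W ∩ co x) ≤? # (common W x y) + 4
    ... | yes bal = balanced-step x∈W y∈W xy bal (ih x∈W y∈W xy)
    ... | no ¬bal with any? (λ b → common W x y b Bool.≟ true)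
    ...   | no empty = bipartite-half {W} {x} {y} (λ {v} → ¬-not λ b∈ → empty (v , b∈))
    ...   | yes (b , b∈) = by-degree (# (W ∩ co b) ≤? 2)
      where
      b∈W : b ∈ W
      b∈W = proj₁ (common-∈ {W = W} {x} {y} b∈)
      xb : b ∉ co x
      xb = proj₁ (proj₂ (common-∈ {W = W} {x} {y} b∈))
      yb : b ∉ co y
      yb = proj₂ (proj₂ (common-∈ {W = W} {x} {y} b∈))

      unbalanced : # (common W x y) + 5 ≤ # (W ∩ co y) + # (W ∩ co x)
      unbalanced = ≤-trans (≤-reflexive (+-suc _ 4)) (≰⇒> ¬bal)

      common≥1 : 1 ≤ # (common W x y)
      common≥1 = ≤-trans (m≤n+m 1 _) (size-─-∈ (common W x y) b∈)

      common≤1 : # (common W x y) ≤ 1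
      common≤1 = +-cancelʳ-≤ 5 _ _ (≤-trans unbalanced (+-mono-≤ (degree≤3 W y) (degree≤3 W x)))

      big : 7 ≤ # W
      big = ≤-trans (+-mono-≤ (≤-trans (+-monoˡ-≤ 5 common≥1) unbalanced) common≥1)
                    (≤-trans (≤-reflexive (+-assoc (# (W ∩ co y)) _ _)) (size≥ W xy))

      neighbour≥3 : 3 ≤ # (W ∩ co y)
      neighbour≥3 = +-cancelʳ-≤ 3 _ _ (≤-trans (+-monoˡ-≤ 5 common≥1) (≤-trans unbalanced (+-monoʳ-≤ (# (W ∩ co y)) (degree≤3 W x))))

      degree-split : # (W ∩ co b) + 1 ≤ # (W ∩ co b ∩ co y) + (# (W ∩ co b ∩ co x) + # (common W x y))
      degree-split = subst (λ k → # (W ∩ co b) + k ≤ # (W ∩ co b ∩ co y) + (# (W ∩ co b ∩ co x) + # (common W x y))) (#-singleton b)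
        (total-mono (W ∩ co b) (⁅ b ⁆ ∷ []) (W ∩ co b ∩ co y) (W ∩ co b ∩ co x ∷ common W x y ∷ [])
          λ v → taut (W v) (co x v) (co y v) (co b v) (⁅ b ⁆ v) (⁅⁆-∈ {p = common W x y} b∈) (⁅⁆-∉ {p = co b} (co-irrefl b)))
        where
        taut : ∀ w p q r e → (e ≡ true → w ∧ not p ∧ not q ≡ true) → (e ≡ true → r ≡ false) →
               bit (w ∧ r) + bit e ≤ bit (w ∧ r ∧ q) + (bit (w ∧ r ∧ p) + bit (w ∧ not p ∧ not q))
        taut = decided (all-Bool? λ w → all-Bool? λ p → all-Bool? λ q → all-Bool? λ r → all-Bool? λ e →
                 (e Bool.≟ true ⇒? (w ∧ not p ∧ not q) Bool.≟ true) ⇒? (e Bool.≟ true ⇒? r Bool.≟ false) ⇒? _ ≤? _)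

      -- N(z) has at most 3 elements, and one of them, t, is not a co-neighbour of b.
      shared≤2 : ∀ {z t} → t ∈ W → t ∈ co z → b ∉ co t → # (W ∩ co b ∩ co z) ≤ 2
      shared≤2 {z} {t} t∈W zt tb = +-cancelʳ-≤ 1 _ _ (≤-trans
        (subst (λ k → # (W ∩ co b ∩ co z) + k ≤ # (W ∩ co z)) (#-singleton t)
          (total-mono (W ∩ co b ∩ co z) (⁅ t ⁆ ∷ []) (W ∩ co z) []
            λ v → taut (W v) (co z v) (co b v) (⁅ t ⁆ v) (⁅⁆-∈ {p = W ∩ co z} (∈-∩ {p = W} {q = co z} t∈W zt))
                       (⁅⁆-∉ {p = co b} (¬co-sym tb))))
        (degree≤3 W z))
        where
        taut : ∀ w q r e → (e ≡ true → w ∧ q ≡ true) → (e ≡ true → r ≡ false) →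
               bit (w ∧ r ∧ q) + bit e ≤ bit (w ∧ q)
        taut = decided (all-Bool? λ w → all-Bool? λ q → all-Bool? λ r → all-Bool? λ e →
                 (e Bool.≟ true ⇒? (w ∧ q) Bool.≟ true) ⇒? (e Bool.≟ true ⇒? r Bool.≟ false) ⇒? _ ≤? _)

      reduce-at : ∀ {c d} → c ∈ W → d ∈ W → d ∈ co c → # (W ∩ co c) ≤ 2 → Half W
      reduce-at {c} {d} c∈W d∈W cd low = balanced-step c∈W d∈W cd (low-degree-balanced {W} {c} {d} big low) (ih c∈W d∈W cd)

      common≤1′ : # (common W y x) ≤ 1
      common≤1′ = ≤-trans (common-swap W y x) common≤1

      shared-∈ : ∀ {z c} → c ∈ W ∩ co b ∩ co z → c ∈ W × c ∈ co b × c ∈ co z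
      shared-∈ {z} {c} h with W c | co b c | co z c
      ... | true | true | true = refl , refl , refl

      by-degree : Dec (# (W ∩ co b) ≤ 2) → Half W
      by-degree (yes low) with any? (λ q → (W q Bool.≟ true) ×-dec (co b q Bool.≟ true))
      ... | yes (q , q∈W , bq) = reduce-at b∈W q∈W bq low
      -- An isolated b together with the three vertices of N(y) would be a clique of size 4.
      ... | no isolated = ⊥-elim (1+n≰n (≤-trans (+-monoˡ-≤ 1 neighbour≥3)
               (≤-trans (size-∪ (W ∩ co y) b∉) (clique≤3 _ cl))))
        where
        free : ∀ {v} → v ∈ W → v ∉ co b
        free {v} v∈W = ¬-not λ bv → isolated (v , v∈W , bv)
        b∉ : b ∉ W ∩ co y
        b∉ = ∉-⊆ {p = W ∩ co y} {q = co y} (∩-⊆ʳ {p = W} {q = co y}) yb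
        cl : Clique ((W ∩ co y) ∪ ⁅ b ⁆)
        cl {u} {v} u∈ v∈ with ∪-case {p = W ∩ co y} {q = ⁅ b ⁆} {v = u} u∈ | ∪-case {p = W ∩ co y} {q = ⁅ b ⁆} {v = v} v∈
        ... | inj₁ u∈ | inj₁ v∈ = trace-clique W y u∈ v∈
        ... | inj₁ u∈ | inj₂ v≡b rewrite ⁅⁆-≡ {x = b} {v = v} v≡b = ¬co-sym (free (∩-⊆ˡ {p = W} {co y} u∈))
        ... | inj₂ u≡b | inj₁ v∈ rewrite ⁅⁆-≡ {x = b} {v = u} u≡b = free (∩-⊆ˡ {p = W} {co y} v∈)
        ... | inj₂ u≡b | inj₂ v≡b rewrite ⁅⁆-≡ {x = b} {v = u} u≡b | ⁅⁆-≡ {x = b} {v = v} v≡b = co-irrefl b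
      by-degree (no high) = by-sides (2 ≤? # (W ∩ co b ∩ co y)) (2 ≤? # (W ∩ co b ∩ co x))
        where
        sides : 3 ≤ # (W ∩ co b ∩ co y) + # (W ∩ co b ∩ co x)
        sides = +-cancelʳ-≤ 1 _ _ (≤-trans (+-monoˡ-≤ 1 (≰⇒> high)) (≤-trans degree-split
          (≤-trans (≤-reflexive (sym (+-assoc (# (W ∩ co b ∩ co y)) _ _))) (+-monoʳ-≤ _ common≤1))))

        side-y : 1 ≤ # (W ∩ co b ∩ co y)
        side-y = +-cancelʳ-≤ 2 _ _ (≤-trans sides (+-monoʳ-≤ _ (shared≤2 y∈W xy yb)))

        side-x : 1 ≤ # (W ∩ co b ∩ co x)
        side-x = +-cancelˡ-≤ 2 _ _ (≤-trans sides (+-monoˡ-≤ _ (shared≤2 x∈W (co-sym xy) xb)))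

        by-sides : Dec (2 ≤ # (W ∩ co b ∩ co y)) → Dec (2 ≤ # (W ∩ co b ∩ co x)) → Half W
        by-sides (yes two) _ with inhabited (W ∩ co b ∩ co x) side-x
        ... | c , c∈ with shared-∈ {x} c∈
        ... | c∈W , bc , xc = reduce-at c∈W x∈W (co-sym xc) (low-degree {W} {x} {y} {b} xc bc (degree≤3 W y) common≤1 two)
        by-sides (no _) (yes two) with inhabited (W ∩ co b ∩ co y) side-y
        ... | c , c∈ with shared-∈ {y} c∈
        ... | c∈W , bc , yc = reduce-at c∈W y∈W (co-sym yc) (low-degree {W} {y} {x} {b} yc bc (degree≤3 W x) common≤1′ two)
        by-sides (no ¬two) (no ¬two′) = ⊥-elim (1+n≰n (≤-trans sides (+-mono-≤ (≤-pred (≰⇒> ¬two)) (≤-pred (≰⇒> ¬two′)))))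

-- Blow-ups of the 5-cycle

module Blowup {n : ℕ} (G : Graph n) (α : α≤ G 2) where
  open Independence2 G α
  open Reduction G α
  open Patterns G α

  full : Subset n
  full _ = true

  No2K₂ : Set
  No2K₂ = ∀ {p q r s} → q ∈ co p → s ∈ co r → r ∉ co p → s ∉ co p → r ∉ co q → s ∉ co q → ⊥

  -- What a vertex v sees of consecutive cycle vertices f₀, f₁, f₂, f₃: if it is joined to f₀ in
  -- `co`, then not to f₁ (triangle), but to f₂ or f₃ (otherwise v f₀ and f₂ f₃ form 2K₂). Around
  -- the cycle this leaves no neighbour at all or exactly two, which are not consecutive.
  Spread : Bool → Bool → Bool → Bool → Set
  Spread a b c d = (a ≡ true → b ≡ false) × (a ≡ true → c ∨ d ≡ true)

  Profile : Bool → Bool → Bool → Bool → Bool → Set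
  Profile a b c d e = Spread a b c d × Spread b c d e × Spread c d e a × Spread d e a b × Spread e a b c

  spread? : ∀ a b c d → Dec (Spread a b c d)
  spread? a b c d = (a Bool.≟ true ⇒? b Bool.≟ false) ×-dec (a Bool.≟ true ⇒? (c ∨ d) Bool.≟ true)

  profile? : ∀ a b c d e → Dec (Profile a b c d e)
  profile? a b c d e = spread? a b c d ×-dec spread? b c d e ×-dec spread? c d e a ×-dec spread? d e a b ×-dec spread? e a b c

  module Pentagon (no2K₂ : No2K₂) {f₀ f₁ f₂ f₃ f₄ : V} (f₀₁ : f₁ ∈ co f₀) (f₁₂ : f₂ ∈ co f₁) (f₂₃ : f₃ ∈ co f₂)
                  (f₃₄ : f₄ ∈ co f₃) (f₄₀ : f₀ ∈ co f₄) where

    -- Every vertex lies in U, the isolated vertices of the complement, or in exactly one cᵢ.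
    U c₀ c₁ c₂ c₃ c₄ : Subset n
    U  = ∁ (co f₀) ∩ ∁ (co f₁) ∩ ∁ (co f₂) ∩ ∁ (co f₃) ∩ ∁ (co f₄)
    c₀ = co f₄ ∩ co f₁
    c₁ = co f₀ ∩ co f₂
    c₂ = co f₁ ∩ co f₃
    c₃ = co f₂ ∩ co f₄
    c₄ = co f₃ ∩ co f₀

    profile : ∀ v → Profile (co f₀ v) (co f₁ v) (co f₂ v) (co f₃ v) (co f₄ v)
    profile v = spread f₀₁ f₁₂ f₂₃ f₃₄ f₄₀ , spread f₁₂ f₂₃ f₃₄ f₄₀ f₀₁ , spread f₂₃ f₃₄ f₄₀ f₀₁ f₁₂
              , spread f₃₄ f₄₀ f₀₁ f₁₂ f₂₃ , spread f₄₀ f₀₁ f₁₂ f₂₃ f₃₄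
      where
      spread : ∀ {a b c d e} → b ∈ co a → c ∈ co b → d ∈ co c → e ∈ co d → a ∈ co e →
               Spread (co a v) (co b v) (co c v) (co d v)
      spread {a} {b} {c} {d} {e} ab bc cd de ea = disjoint-neighbourhoods ab , both
        where
        both : v ∈ co a → co c v ∨ co d v ≡ true
        both av with co c v in cv | co d v in dv
        ... | true  | _     = refl
        ... | false | true  = refl
        ... | false | false = ⊥-elim (no2K₂ cd (co-sym av) cv (co-triangle-free (co-sym bc) (co-sym ab)) dv (co-triangle-free de ea))

    U-∉ : ∀ {v} → v ∈ U → v ∉ co f₀ × v ∉ co f₁ × v ∉ co f₂ × v ∉ co f₃ × v ∉ co f₄
    U-∉ {v} h with co f₀ v | co f₁ v | co f₂ v | co f₃ v | co f₄ v
    ... | false | false | false | false | false = refl , refl , refl , refl , refl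

    -- If v had a co-neighbour w, then w would be joined to an end of every edge of the 5-cycle,
    -- lest that edge and vw form 2K₂. But no two consecutive cycle vertices are neighbours of w,
    -- and such a set cannot meet every edge of an odd cycle.
    U-universal : ∀ {v w} → v ∈ U → w ∉ co v
    U-universal {v} {w} v∈U with U-∉ v∈U
    ... | v₀ , v₁ , v₂ , v₃ , v₄ = ¬-not λ vw →
      odd (co f₀ w) (co f₁ w) (co f₂ w) (co f₃ w) (co f₄ w) (profile w)
          (hit vw f₀₁ v₀ v₁) (hit vw f₁₂ v₁ v₂) (hit vw f₂₃ v₂ v₃) (hit vw f₃₄ v₃ v₄) (hit vw f₄₀ v₄ v₀)
      where
      hit : ∀ {p q} → w ∈ co v → q ∈ co p → v ∉ co p → v ∉ co q → co p w ∨ co q w ≡ true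
      hit {p} {q} vw pq pv qv with co p w in pw | co q w in qw
      ... | true  | _     = refl
      ... | false | true  = refl
      ... | false | false = ⊥-elim (no2K₂ pq vw pv pw qv qw)

      odd : ∀ a b c d e → Profile a b c d e → a ∨ b ≡ true → b ∨ c ≡ true → c ∨ d ≡ true → d ∨ e ≡ true → e ∨ a ≡ true → ⊥
      odd = decided (all-Bool? λ a → all-Bool? λ b → all-Bool? λ c → all-Bool? λ d → all-Bool? λ e →
              profile? a b c d e ⇒? (a ∨ b) Bool.≟ true ⇒? (b ∨ c) Bool.≟ true ⇒? (c ∨ d) Bool.≟ true ⇒?
              (d ∨ e) Bool.≟ true ⇒? (e ∨ a) Bool.≟ true ⇒? no λ ())

    U∪-clique : ∀ {p : Subset n} → Clique p → Clique (U ∪ p)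
    U∪-clique {p} cl {u} {v} u∈ v∈ with ∪-case {p = U} {q = p} {v = u} u∈ | ∪-case {p = U} {q = p} {v = v} v∈
    ... | inj₁ u∈U | _        = U-universal u∈U
    ... | inj₂ _   | inj₁ v∈U = ¬co-sym (U-universal v∈U)
    ... | inj₂ u∈p | inj₂ v∈p = cl u∈p v∈p

    size-full : # full ≤ # U + (# c₀ + (# c₁ + (# c₂ + (# c₃ + # c₄))))
    size-full = total-mono full [] U (c₀ ∷ c₁ ∷ c₂ ∷ c₃ ∷ c₄ ∷ []) λ v →
        taut (co f₀ v) (co f₁ v) (co f₂ v) (co f₃ v) (co f₄ v) (profile v)
      where
      taut : ∀ a b c d e → Profile a b c d e →
             1 ≤ bit (not a ∧ not b ∧ not c ∧ not d ∧ not e) +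
                 (bit (e ∧ b) + (bit (a ∧ c) + (bit (b ∧ d) + (bit (c ∧ e) + bit (d ∧ a)))))
      taut = decided (all-Bool? λ a → all-Bool? λ b → all-Bool? λ c → all-Bool? λ d → all-Bool? λ e →
               profile? a b c d e ⇒? _ ≤? _)

    -- For a cycle vertex z, N(z) consists of the two classes next to z, and U ∪ N(z) is a clique.
    -- Either it already has half of the vertices, or its smallness feeds the final count. In the
    -- applications l and r are the two cycle vertices not joined to z.
    dominated : ∀ {l z r} → l ∈ co r → (∀ {v} → v ∈ U → v ∉ co z) →
                Half full ⊎ (# U + (# (co l ∩ co z) + # (co z ∩ co r))) + (# U + (# (co l ∩ co z) + # (co z ∩ co r))) + 1 ≤ # full
    dominated {l} {z} {r} rl U≁z with # full ≤? # (U ∪ co z) + # (U ∪ co z)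
    ... | yes le = inj₁ (clique-half {Q = U ∪ co z} (λ _ → refl) (U∪-clique {co z} neighbourhood-clique) le)
    ... | no  gt = inj₂ (≤-trans (+-monoˡ-≤ 1 (+-mono-≤ size size)) (≤-trans (≤-reflexive (+-comm _ 1)) (≰⇒> gt)))
      where
      size : # U + (# (co l ∩ co z) + # (co z ∩ co r)) ≤ # (U ∪ co z)
      size = total-mono U (co l ∩ co z ∷ co z ∩ co r ∷ []) (U ∪ co z) []
          λ v → taut (U v) (co l v) (co z v) (co r v) U≁z (disjoint-neighbourhoods rl)
        where
        taut : ∀ u l z r → (u ≡ true → z ≡ false) → (r ≡ true → l ≡ false) →
               bit u + (bit (l ∧ z) + bit (z ∧ r)) ≤ bit (u ∨ z)
        taut = decided (all-Bool? λ u → all-Bool? λ l → all-Bool? λ z → all-Bool? λ r →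
                 (u Bool.≟ true ⇒? z Bool.≟ false) ⇒? (r Bool.≟ true ⇒? l Bool.≟ false) ⇒? _ ≤? _)

    c₁-∉c₂ : ∀ {v} → v ∈ c₁ → v ∉ c₂
    c₁-∉c₂ v∈ = ∉-⊆ {p = c₂} {q = co f₁} (∩-⊆ˡ {p = co f₁} {q = co f₃})
                      (disjoint-neighbourhoods f₀₁ (∩-⊆ˡ {p = co f₀} {q = co f₂} v∈))

    c₂-∉c₁ : ∀ {v} → v ∈ c₂ → v ∉ c₁
    c₂-∉c₁ {v} v∈ = ¬-not λ v∈c₁ → ∈-∉ {p = c₂} v∈ (c₁-∉c₂ v∈c₁)

    -- Otherwise x f₃ and y f₀ would form 2K₂ in `co`.
    c₁-c₂-joined : ∀ {x y} → x ∈ c₂ → y ∈ c₁ → y ∈ co x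
    c₁-c₂-joined {x} {y} x∈ y∈ with co x y in xy
    ... | true  = refl
    ... | false = ⊥-elim (no2K₂ (co-sym x₃) (co-sym y₀) xy (¬co-sym (disjoint-neighbourhoods (co-sym f₀₁) x₁))
                    (disjoint-neighbourhoods f₂₃ y₂) (co-triangle-free f₃₄ f₄₀))
      where
      x₁ = ∩-⊆ˡ {p = co f₁} {q = co f₃} x∈
      x₃ = ∩-⊆ʳ {p = co f₁} {q = co f₃} x∈
      y₀ = ∩-⊆ˡ {p = co f₀} {q = co f₂} y∈
      y₂ = ∩-⊆ʳ {p = co f₀} {q = co f₂} y∈

    -- Starting from the clique U ∪ c₀ ∪ T, attach the vertices of X ⊆ c₂ one at a time, each paired with
    -- its own vertex of Y ⊆ c₁; the detours to T run through c₄.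
    module Center {T : Subset n} (T⊆c₃ : T ⊆ c₃) (T≤c₄ : # T ≤ # c₄) where

      S₀ R : Subset n
      S₀ = U ∪ c₀ ∪ T
      R  = S₀ ∪ c₂

      W[_,_] : Subset n → Subset n → Subset n
      W[ X , Y ] = (∁ c₁ ∩ ∁ c₂) ∪ X ∪ Y

      data Place (v : V) : Set where
        inU : v ∈ U → Place v
        in₀ : v ∈ co f₄ → v ∈ co f₁ → Place v
        inT : v ∈ T → v ∈ co f₂ → v ∈ co f₄ → Place v

      place : ∀ {v} → v ∈ S₀ → Place v
      place {v} h with ∪-case {p = U} {q = c₀ ∪ T} {v = v} h
      ... | inj₁ v∈U = inU v∈U
      ... | inj₂ h′ with ∪-case {p = c₀} {q = T} {v = v} h′
      ...   | inj₁ v∈c₀ = in₀ (∩-⊆ˡ {p = co f₄} {q = co f₁} v∈c₀) (∩-⊆ʳ {p = co f₄} {q = co f₁} v∈c₀)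
      ...   | inj₂ v∈T  = inT v∈T (∩-⊆ˡ {p = co f₂} {q = co f₄} (T⊆c₃ v∈T)) (∩-⊆ʳ {p = co f₂} {q = co f₄} (T⊆c₃ v∈T))

      S₀-clique : Clique S₀
      S₀-clique u∈ v∈ with place u∈ | place v∈
      ... | inU u∈U    | _          = U-universal u∈U
      ... | in₀ _ _    | inU v∈U    = ¬co-sym (U-universal v∈U)
      ... | inT _ _ _  | inU v∈U    = ¬co-sym (U-universal v∈U)
      ... | in₀ u₄ _   | in₀ v₄ _   = neighbourhood-clique u₄ v₄
      ... | in₀ u₄ _   | inT _ _ v₄ = neighbourhood-clique u₄ v₄
      ... | inT _ _ u₄ | in₀ v₄ _   = neighbourhood-clique u₄ v₄
      ... | inT _ _ u₄ | inT _ _ v₄ = neighbourhood-clique u₄ v₄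

      outside : ∀ {v} → v ∉ c₁ → v ∉ c₂ → ∀ {X Y} → v ∈ W[ X , Y ]
      outside v∉c₁ v∉c₂ rewrite v∉c₁ | v∉c₂ = refl

      ∉co⇒∉c₁ : ∀ {v} → v ∉ co f₀ → v ∉ c₁
      ∉co⇒∉c₁ {v} h = ∉-⊆ {p = c₁} {q = co f₀} (∩-⊆ˡ {p = co f₀} {q = co f₂}) h

      ∉co⇒∉c₂ : ∀ {v} → v ∉ co f₁ → v ∉ c₂
      ∉co⇒∉c₂ {v} h = ∉-⊆ {p = c₂} {q = co f₁} (∩-⊆ˡ {p = co f₁} {q = co f₃}) h

      ∉co⇒∉c₂′ : ∀ {v} → v ∉ co f₃ → v ∉ c₂
      ∉co⇒∉c₂′ {v} h = ∉-⊆ {p = c₂} {q = co f₃} (∩-⊆ʳ {p = co f₁} {q = co f₃}) h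

      S₀⊆W : ∀ {X Y} → S₀ ⊆ W[ X , Y ]
      S₀⊆W {X} {Y} {v} v∈ with place v∈
      ... | inU v∈U    = outside {v} (∉co⇒∉c₁ (proj₁ (U-∉ v∈U))) (∉co⇒∉c₂ (proj₁ (proj₂ (U-∉ v∈U)))) {X} {Y}
      ... | in₀ v₄ _   = outside {v} (∉co⇒∉c₁ (disjoint-neighbourhoods f₄₀ v₄))
                                     (∉co⇒∉c₂′ (disjoint-neighbourhoods (co-sym f₃₄) v₄)) {X} {Y}
      ... | inT _ v₂ v₄ = outside {v} (∉co⇒∉c₁ (disjoint-neighbourhoods f₄₀ v₄))
                                      (∉co⇒∉c₂ (disjoint-neighbourhoods (co-sym f₁₂) v₂)) {X} {Y}

      c₄⊆W : ∀ {X Y} → c₄ ⊆ W[ X , Y ]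
      c₄⊆W {X} {Y} {v} v∈ = outside {v}
          (∉-⊆ {p = c₁} {q = co f₂} (∩-⊆ʳ {p = co f₀} {q = co f₂}) (disjoint-neighbourhoods (co-sym f₂₃) v₃))
          (∉co⇒∉c₂ (disjoint-neighbourhoods f₀₁ v₀)) {X} {Y}
        where
        v₃ = ∩-⊆ˡ {p = co f₃} {q = co f₀} v∈
        v₀ = ∩-⊆ʳ {p = co f₃} {q = co f₀} v∈

      -- `U` is isolated in `co`, and c₀ and c₂ consist, like x, of co-neighbours of f₁. Among the
      -- parts of `R` only `T` is left.
      R-∩co : ∀ {x v} → x ∈ c₂ → v ∈ R → v ∈ co x → v ∈ T
      R-∩co {x} {v} x∈ v∈ xv with ∪-case {p = S₀} {q = c₂} {v = v} v∈
      ... | inj₂ v∈c₂ = ⊥-elim (no-triangle (∩-⊆ˡ {p = co f₁} {q = co f₃} x∈) xv (∩-⊆ˡ {p = co f₁} {q = co f₃} v∈c₂))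
      ... | inj₁ v∈S₀ with place v∈S₀
      ...   | inU v∈U     = ⊥-elim (∈-∉ {p = co v} (co-sym xv) (U-universal v∈U))
      ...   | in₀ _ v₁    = ⊥-elim (no-triangle (∩-⊆ˡ {p = co f₁} {q = co f₃} x∈) xv v₁)
      ...   | inT v∈T _ _ = v∈T

      c₄-∉R : ∀ {v} → v ∈ c₄ → v ∉ R
      c₄-∉R {v} v∈ = ¬-not impossible
        where
        v₃ = ∩-⊆ˡ {p = co f₃} {q = co f₀} v∈
        v₀ = ∩-⊆ʳ {p = co f₃} {q = co f₀} v∈
        impossible : ¬ v ∈ R
        impossible v∈R with ∪-case {p = S₀} {q = c₂} {v = v} v∈R
        ... | inj₂ v∈c₂ = no-triangle f₀₁ (∩-⊆ˡ {p = co f₁} {q = co f₃} v∈c₂) v₀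
        ... | inj₁ v∈S₀ with place v∈S₀
        ...   | inU v∈U    = ∈-∉ {p = co f₀} v₀ (proj₁ (U-∉ v∈U))
        ...   | in₀ v₄ _   = no-triangle f₃₄ v₄ v₃
        ...   | inT _ _ v₄ = no-triangle f₃₄ v₄ v₃

      S₀-size : # U + (# c₀ + # T) ≤ # S₀
      S₀-size = total-mono U (c₀ ∷ T ∷ []) S₀ [] λ v →
          taut (co f₀ v) (co f₁ v) (co f₂ v) (co f₃ v) (co f₄ v) (T v) (profile v) T⊆c₃
        where
        taut : ∀ a b c d e t → Profile a b c d e → (t ≡ true → c ∧ e ≡ true) →
               bit (not a ∧ not b ∧ not c ∧ not d ∧ not e) + (bit (e ∧ b) + bit t) ≤
               bit ((not a ∧ not b ∧ not c ∧ not d ∧ not e) ∨ (e ∧ b) ∨ t)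
        taut = decided (all-Bool? λ a → all-Bool? λ b → all-Bool? λ c → all-Bool? λ d → all-Bool? λ e → all-Bool? λ t →
                 profile? a b c d e ⇒? (t Bool.≟ true ⇒? (c ∧ e) Bool.≟ true) ⇒? _ ≤? _)

      grow : ∀ j {X Y} → X ⊆ c₂ → Y ⊆ c₁ → j ≤ # X → j ≤ # Y →
             ∃ λ S → Immersed W[ X , Y ] S × (S ⊆ R) × # U + (# c₀ + # T) + j ≤ # S
      grow zero {X} {Y} _ _ _ _ =
        S₀ , clique-immersed (S₀⊆W {X} {Y}) S₀-clique , ∪-⊆ˡ {p = S₀} {q = c₂} , ≤-trans (≤-reflexive (+-identityʳ _)) S₀-size
      grow (suc j) {X} {Y} X⊆c₂ Y⊆c₁ j≤X j≤Y
        with inhabited X (≤-trans (s≤s z≤n) j≤X) | inhabited Y (≤-trans (s≤s z≤n) j≤Y)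
      ... | x , x∈X | y , y∈Y
        with grow j {X ─ x} {Y ─ y} (λ h → X⊆c₂ (─-⊆ {W = X} {x = x} h)) (λ h → Y⊆c₁ (─-⊆ {W = Y} {x = y} h))
                  (smaller X x j≤X) (smaller Y y j≤Y)
        where
        smaller : ∀ Z z → suc j ≤ # Z → j ≤ # (Z ─ z)
        smaller Z z le = +-cancelʳ-≤ 1 _ _ (≤-trans (≤-reflexive (+-comm j 1)) (≤-trans le (size-─ Z z)))
      ... | S , I , S⊆R , le =
        S ∪ ⁅ x ⁆ , immersed-mono W⁺⊆W (extend c₄ I xy x∉W′ y∉W′ c₄-free detours) , S⁺⊆R
        , ≤-trans (≤-reflexive (+-suc _ j)) (≤-trans (s≤s le) (≤-trans (≤-reflexive (+-comm 1 _)) (size-∪ S x∉S)))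
        where
        W′ : Subset n
        W′ = W[ X ─ x , Y ─ y ]

        x∈c₂ : x ∈ c₂
        x∈c₂ = X⊆c₂ x∈X

        y∈c₁ : y ∈ c₁
        y∈c₁ = Y⊆c₁ y∈Y

        xy : y ∈ co x
        xy = c₁-c₂-joined x∈c₂ y∈c₁

        x∉W′ : x ∉ W′
        x∉W′ rewrite x∈c₂ | c₂-∉c₁ x∈c₂ =
          cong₂ _∨_ (─-∉ {W = X} {x = x}) (∉-⊆ {p = Y ─ y} {q = c₁} (λ h → Y⊆c₁ (─-⊆ {W = Y} {x = y} h)) (c₂-∉c₁ x∈c₂))

        y∉W′ : y ∉ W′
        y∉W′ rewrite y∈c₁ =
          cong₂ _∨_ (∉-⊆ {p = X ─ x} {q = c₂} (λ h → X⊆c₂ (─-⊆ {W = X} {x = x} h)) (c₁-∉c₂ y∈c₁)) (─-∉ {W = Y} {x = y})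

        x∉S : x ∉ S
        x∉S = ∉-⊆ {p = S} {q = W′} (Immersed.S⊆W I) x∉W′

        -- Vertices of c₄ share the co-neighbour f₃ with x and f₀ with y, so in G they are adjacent
        -- to both. All of c₄ is available in every round, since it is disjoint from `R`.
        c₄-free : ∀ {v} → v ∈ c₄ → v ∈ W′ × v ∉ S × v ∉ co x × v ∉ co y
        c₄-free {v} v∈ = c₄⊆W {X ─ x} {Y ─ y} v∈ , ∉-⊆ {p = S} {q = R} S⊆R (c₄-∉R v∈)
          , neighbourhood-clique (∩-⊆ʳ {p = co f₁} {q = co f₃} x∈c₂) (∩-⊆ˡ {p = co f₃} {q = co f₀} v∈)
          , neighbourhood-clique (∩-⊆ˡ {p = co f₀} {q = co f₂} y∈c₁) (∩-⊆ʳ {p = co f₃} {q = co f₀} v∈)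

        detours : # (S ∩ co x) ≤ # c₄
        detours = ≤-trans (#-mono {p = S ∩ co x} {q = T} λ {v} h →
          R-∩co x∈c₂ (S⊆R (∩-⊆ˡ {p = S} {q = co x} h)) (∩-⊆ʳ {p = S} {q = co x} {v = v} h)) T≤c₄

        S⁺⊆R : S ∪ ⁅ x ⁆ ⊆ R
        S⁺⊆R {v} h = [ S⊆R , (λ v≡x → ∪-⊆ʳ {p = S₀} {q = c₂} {v = v} (⁅⁆-∈ {p = c₂} x∈c₂ v≡x)) ]′
                       (∪-case {p = S} {q = ⁅ x ⁆} {v = v} h)

        W⁺⊆W : W′ ∪ ⁅ x ⁆ ∪ ⁅ y ⁆ ⊆ W[ X , Y ]
        W⁺⊆W {v} = taut (not (c₁ v) ∧ not (c₂ v)) (X v) (Y v) (⁅ x ⁆ v) (⁅ y ⁆ v) (⁅⁆-∈ {p = X} x∈X) (⁅⁆-∈ {p = Y} y∈Y)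
          where
          taut : ∀ r p q a b → (a ≡ true → p ≡ true) → (b ≡ true → q ≡ true) →
                 (r ∨ (p ∧ not a) ∨ (q ∧ not b)) ∨ a ∨ b ≡ true → r ∨ p ∨ q ≡ true
          taut = decided (all-Bool? λ r → all-Bool? λ p → all-Bool? λ q → all-Bool? λ a → all-Bool? λ b →
                   (a Bool.≟ true ⇒? p Bool.≟ true) ⇒? (b Bool.≟ true ⇒? q Bool.≟ true) ⇒? _ Bool.≟ _ ⇒? _ Bool.≟ _)

    -- The branch set has at least |U| + |c₀| + min(|c₃|, |c₄|) + min(|c₁|, |c₂|) vertices. When the
    -- two classes lost to the minima form the neighbourhood of a cycle vertex, `dominated` bounds
    -- them by less than half of all vertices, so the rest is large enough.
    spread-half : # c₃ ≤ # c₀ → Half full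
    spread-half c₃≤c₀ with subset-of-size c₃ (# c₃ ⊓ # c₄) (m⊓n≤m _ _)
    ... | T , T⊆c₃ , T-size with Center.grow {T} T⊆c₃ (≤-trans (≤-reflexive T-size) (m⊓n≤n (# c₃) (# c₄)))
                                   (# c₂ ⊓ # c₁) {c₂} {c₁} (λ h → h) (λ h → h) (m⊓n≤m _ _) (m⊓n≤n (# c₂) (# c₁))
    ... | S , I , _ , S-size = conclude (⊓-sel (# c₃) (# c₄)) (⊓-sel (# c₂) (# c₁))
      where
      finish : ∀ a b → Half full ⊎ (# U + (a + b)) + (# U + (a + b)) + 1 ≤ # full →
               # c₀ + (# c₁ + (# c₂ + (# c₃ + # c₄))) ≤ (a + b) + (# c₀ + (# T + (# c₂ ⊓ # c₁))) → Half full
      finish _ _ (inj₁ half) _ = half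
      finish a b (inj₂ small) split = S , immersed-mono (λ _ → refl) I ,
          arith (# full) (# U) (a + b) (# c₀ + (# c₁ + (# c₂ + (# c₃ + # c₄)))) _ (# S) small size-full split
                (≤-trans (≤-reflexive (reassoc (# U) (# c₀) (# T) (# c₂ ⊓ # c₁))) S-size)
        where
        reassoc : ∀ u c t j → u + (c + (t + j)) ≡ u + (c + t) + j
        reassoc = solve-∀

        arith : ∀ n u A σ p s → (u + A) + (u + A) + 1 ≤ n → n ≤ u + σ → σ ≤ A + p → u + p ≤ s → n ≤ s + s
        arith n u A σ p s h₁ h₂ h₃ h₄ with n ≤? s + s
        ... | yes le = le
        ... | no  gt = ⊥-elim (⊥-from-≤ (u + u + 1) (+-mono-≤ (+-mono-≤ h₁ (≰⇒> gt)) (+-mono-≤ (+-mono-≤ h₂ h₂)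
                         (+-mono-≤ (+-mono-≤ h₃ h₃) (+-mono-≤ h₄ h₄)))) (eq n u A σ p s))
          where
          eq : ∀ n u A σ p s →
               (((u + A) + (u + A) + 1) + suc (s + s)) + ((n + n) + ((σ + σ) + ((u + p) + (u + p)))) ≡
               suc (((n + n) + (((u + σ) + (u + σ)) + (((A + p) + (A + p)) + (s + s)))) + (u + u + 1))
          eq = solve-∀

      conclude : # c₃ ⊓ # c₄ ≡ # c₃ ⊎ # c₃ ⊓ # c₄ ≡ # c₄ → # c₂ ⊓ # c₁ ≡ # c₂ ⊎ # c₂ ⊓ # c₁ ≡ # c₁ → Half full
      conclude (inj₁ t) (inj₁ j) = finish (# c₄) (# c₁) (dominated {f₃} {f₀} {f₂} f₂₃ λ h → proj₁ (U-∉ h)) (≤-reflexive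
          (trans (eq (# c₀) (# c₁) (# c₂) (# c₃) (# c₄)) (cong₂ (λ s r → # c₄ + # c₁ + (# c₀ + (s + r))) (sym (trans T-size t)) (sym j))))
        where
        eq : ∀ a b c d e → a + (b + (c + (d + e))) ≡ e + b + (a + (d + c))
        eq = solve-∀
      conclude (inj₁ t) (inj₂ j) = finish (# c₂) (# c₄) (dominated {f₁} {f₃} {f₀} f₀₁ λ h → proj₁ (proj₂ (proj₂ (proj₂ (U-∉ h))))) (≤-reflexive
          (trans (eq (# c₀) (# c₁) (# c₂) (# c₃) (# c₄)) (cong₂ (λ s r → # c₂ + # c₄ + (# c₀ + (s + r))) (sym (trans T-size t)) (sym j))))
        where
        eq : ∀ a b c d e → a + (b + (c + (d + e))) ≡ c + e + (a + (d + b))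
        eq = solve-∀
      conclude (inj₂ t) (inj₁ j) = finish (# c₁) (# c₃) (dominated {f₀} {f₂} {f₄} f₄₀ λ h → proj₁ (proj₂ (proj₂ (U-∉ h)))) (≤-reflexive
          (trans (eq (# c₀) (# c₁) (# c₂) (# c₃) (# c₄)) (cong₂ (λ s r → # c₁ + # c₃ + (# c₀ + (s + r))) (sym (trans T-size t)) (sym j))))
        where
        eq : ∀ a b c d e → a + (b + (c + (d + e))) ≡ b + d + (a + (e + c))
        eq = solve-∀
      -- The classes lost here, c₂ and c₃, are consecutive and form no neighbourhood; |c₃| ≤ |c₀|
      -- lets c₀ take the place of c₃, and c₀ ∪ c₂ is N(f₁).
      conclude (inj₂ t) (inj₂ j) = finish (# c₀) (# c₂) (dominated {f₄} {f₁} {f₃} f₃₄ λ h → proj₁ (proj₂ (U-∉ h))) (≤-trans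
          (+-monoʳ-≤ (# c₀) (+-monoʳ-≤ (# c₁) (+-monoʳ-≤ (# c₂) (+-monoˡ-≤ (# c₄) c₃≤c₀))))
          (≤-reflexive (trans (eq (# c₀) (# c₁) (# c₂) (# c₄))
            (cong₂ (λ s r → # c₀ + # c₂ + (# c₀ + (s + r))) (sym (trans T-size t)) (sym j)))))
        where
        eq : ∀ a b c e → a + (b + (c + (a + e))) ≡ a + c + (a + (e + b))
        eq = solve-∀

  -- The five rotations of the cycle are five chances for the assumption of `spread-half`. If all
  -- failed, then |c₀| < |c₃| < |c₁| < |c₄| < |c₂| < |c₀|, as steps of 3 run through all residues
  -- modulo 5. The order of the conjuncts in each cᵢ makes the rotated classes agree by definition.
  pentagon-half : No2K₂ → ∀ {f₀ f₁ f₂ f₃ f₄} → f₁ ∈ co f₀ → f₂ ∈ co f₁ → f₃ ∈ co f₂ → f₄ ∈ co f₃ → f₀ ∈ co f₄ → Half full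
  pentagon-half no2K₂ f₀₁ f₁₂ f₂₃ f₃₄ f₄₀ =
    by-size (# P₀.c₃ ≤? # P₀.c₀) (# P₀.c₁ ≤? # P₀.c₃) (# P₀.c₄ ≤? # P₀.c₁) (# P₀.c₂ ≤? # P₀.c₄) (# P₀.c₀ ≤? # P₀.c₂)
    where
    module P₀ = Pentagon no2K₂ f₀₁ f₁₂ f₂₃ f₃₄ f₄₀
    module P₁ = Pentagon no2K₂ f₁₂ f₂₃ f₃₄ f₄₀ f₀₁
    module P₂ = Pentagon no2K₂ f₂₃ f₃₄ f₄₀ f₀₁ f₁₂
    module P₃ = Pentagon no2K₂ f₃₄ f₄₀ f₀₁ f₁₂ f₂₃
    module P₄ = Pentagon no2K₂ f₄₀ f₀₁ f₁₂ f₂₃ f₃₄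

    by-size : Dec (# P₀.c₃ ≤ # P₀.c₀) → Dec (# P₀.c₁ ≤ # P₀.c₃) → Dec (# P₀.c₄ ≤ # P₀.c₁) →
              Dec (# P₀.c₂ ≤ # P₀.c₄) → Dec (# P₀.c₀ ≤ # P₀.c₂) → Half full
    by-size (yes le) _ _ _ _ = P₀.spread-half le
    by-size _ (yes le) _ _ _ = P₃.spread-half le
    by-size _ _ (yes le) _ _ = P₁.spread-half le
    by-size _ _ _ (yes le) _ = P₄.spread-half le
    by-size _ _ _ _ (yes le) = P₂.spread-half le
    by-size (no a) (no b) (no c) (no d) (no e) =
      ⊥-elim (<-irrefl refl (<-trans (≰⇒> a) (<-trans (≰⇒> b) (<-trans (≰⇒> c) (<-trans (≰⇒> d) (≰⇒> e))))))

  -- A vertex v outside N(x) ∪ N(y) that has a common co-neighbour a with y and another, c, with x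
  -- closes a 5-cycle v - a - y - x - c. Without one, each such v can be put with N(x) or with N(y)
  -- without creating a co-edge to it, and two co-adjacent vertices missed by x and y would form 2K₂
  -- with xy.
  2K₂-half : No2K₂ → Half full
  2K₂-half no2K₂ with any? (λ x → any? λ y → co x y Bool.≟ true)
  ... | no ¬edge = no-co-edge-half full λ {u} {v} _ _ → ¬-not λ uv → ¬edge (u , v , uv)
  ... | yes (x , y , xy)
    with any? (λ b → any? λ a → any? λ c → (co b a Bool.≟ true) ×-dec (co a y Bool.≟ true) ×-dec
                                           (co x c Bool.≟ true) ×-dec (co c b Bool.≟ true))
  ...   | yes (b , a , c , ba , ay , xc , cb) = pentagon-half no2K₂ ba ay (co-sym xy) xc cb
  ...   | no ¬pentagon = cover (side x y) (side y x) split (side-clique xy) (side-clique (co-sym xy))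
    where
    meets? : ∀ y v → Dec (∃ λ a → v ∈ co a × y ∈ co a)
    meets? y v = any? λ a → (co a v Bool.≟ true) ×-dec (co a y Bool.≟ true)

    side : V → V → Subset n
    side x y v = co y v ∨ (not (co x v) ∧ not (does (meets? y v)))

    data Side (x y v : V) : Set where
      near : v ∈ co y → Side x y v
      far  : v ∉ co x → v ∉ co y → (∀ {a} → v ∈ co a → y ∈ co a → ⊥) → Side x y v

    side-view : ∀ {x y v} → v ∈ side x y → Side x y v
    side-view {x} {y} {v} h with co y v in yv
    ... | true  = near yv
    ... | false with co x v in xv | meets? y v
    ...   | false | no ¬m = far xv yv λ av ay → ¬m (_ , av , ay)

    side-clique : ∀ {x y} → y ∈ co x → Clique (full ∩ side x y)
    side-clique {x} {y} xy {u} {v} u∈ v∈ with side-view {x} {y} {u} u∈ | side-view {x} {y} {v} v∈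
    ... | near yu      | near yv      = neighbourhood-clique yu yv
    ... | near yu      | far _ _ ¬m   = ¬-not λ uv → ¬m uv (co-sym yu)
    ... | far _ _ ¬m   | near yv      = ¬-not λ uv → ¬m (co-sym uv) (co-sym yv)
    ... | far xu yu _  | far xv yv _  = ¬-not λ uv → no2K₂ xy uv xu xv yu yv

    split : ∀ {v} → v ∈ full → v ∈ side x y ⊎ v ∈ side y x
    split {v} _ with co x v in xv | co y v in yv | meets? y v | meets? x v
    ... | _     | true  | _ | _ = inj₁ refl
    ... | true  | false | _ | _ = inj₂ refl
    ... | false | false | no _ | _ = inj₁ refl
    ... | false | false | yes _ | no _ = inj₂ refl
    ... | false | false | yes (a , av , ay) | yes (c , cv , cx) =
      ⊥-elim (¬pentagon (v , a , c , co-sym av , ay , co-sym cx , cv))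

-- Graphs on at most four vertices

-- The upper triangle of an adjacency matrix: data with decidable equality, so that all 64 labelled
-- graphs on four vertices can be searched.
record Pattern : Set where
  constructor pattern₄
  field e₀₁ e₀₂ e₀₃ e₁₂ e₁₃ e₂₃ : Bool

open Pattern

adj₄ : Pattern → Fin 4 → Fin 4 → Bool
adj₄ p zero                   (suc zero)             = e₀₁ p
adj₄ p zero                   (suc (suc zero))       = e₀₂ p
adj₄ p zero                   (suc (suc (suc zero))) = e₀₃ p
adj₄ p (suc zero)             (suc (suc zero))       = e₁₂ p
adj₄ p (suc zero)             (suc (suc (suc zero))) = e₁₃ p
adj₄ p (suc (suc zero))       (suc (suc (suc zero))) = e₂₃ p
adj₄ p (suc zero)             zero                   = e₀₁ p
adj₄ p (suc (suc zero))       zero                   = e₀₂ p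
adj₄ p (suc (suc (suc zero))) zero                   = e₀₃ p
adj₄ p (suc (suc zero))       (suc zero)             = e₁₂ p
adj₄ p (suc (suc (suc zero))) (suc zero)             = e₁₃ p
adj₄ p (suc (suc (suc zero))) (suc (suc zero))       = e₂₃ p
adj₄ p _                      _                      = false

-- The complements of the seven triangle-free graphs on four vertices.
shape : Fin 7 → Pattern
shape zero                                     = pattern₄ true  true  true  true  true  true
shape (suc zero)                               = pattern₄ false true  true  true  true  true
shape (suc (suc zero))                         = pattern₄ false true  true  true  true  false
shape (suc (suc (suc zero)))                   = pattern₄ false true  true  false true  true
shape (suc (suc (suc (suc zero))))             = pattern₄ false true  true  false true  false
shape (suc (suc (suc (suc (suc zero)))))       = pattern₄ false false false true  true  true
shape (suc (suc (suc (suc (suc (suc zero)))))) = pattern₄ false true  false false true  false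

adj₄-irrefl : ∀ p i → adj₄ p i i ≡ false
adj₄-irrefl p zero                   = refl
adj₄-irrefl p (suc zero)             = refl
adj₄-irrefl p (suc (suc zero))       = refl
adj₄-irrefl p (suc (suc (suc zero))) = refl

v₀ v₁ v₂ v₃ : Fin 4
v₀ = zero
v₁ = suc zero
v₂ = suc (suc zero)
v₃ = suc (suc (suc zero))

patternOf : (Fin 4 → Fin 4 → Bool) → Pattern
patternOf h = pattern₄ (h v₀ v₁) (h v₀ v₂) (h v₀ v₃) (h v₁ v₂) (h v₁ v₃) (h v₂ v₃)

adj₄-patternOf : (h : Fin 4 → Fin 4 → Bool) → (∀ i j → h i j ≡ h j i) → (∀ i → h i i ≡ false) →
                 ∀ i j → adj₄ (patternOf h) i j ≡ h i j
adj₄-patternOf h s irr = λ where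
  zero                   zero                   → sym (irr _)
  zero                   (suc zero)             → refl
  zero                   (suc (suc zero))       → refl
  zero                   (suc (suc (suc zero))) → refl
  (suc zero)             zero                   → s _ _
  (suc zero)             (suc zero)             → sym (irr _)
  (suc zero)             (suc (suc zero))       → refl
  (suc zero)             (suc (suc (suc zero))) → refl
  (suc (suc zero))       zero                   → s _ _
  (suc (suc zero))       (suc zero)             → s _ _
  (suc (suc zero))       (suc (suc zero))       → sym (irr _)
  (suc (suc zero))       (suc (suc (suc zero))) → refl
  (suc (suc (suc zero))) zero                   → s _ _
  (suc (suc (suc zero))) (suc zero)             → s _ _
  (suc (suc (suc zero))) (suc (suc zero))       → s _ _
  (suc (suc (suc zero))) (suc (suc (suc zero))) → sym (irr _)

adj₄-sym : ∀ p i j → adj₄ p i j ≡ adj₄ p j i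
adj₄-sym p = λ where
  zero                   zero                   → refl
  zero                   (suc zero)             → refl
  zero                   (suc (suc zero))       → refl
  zero                   (suc (suc (suc zero))) → refl
  (suc zero)             zero                   → refl
  (suc zero)             (suc zero)             → refl
  (suc zero)             (suc (suc zero))       → refl
  (suc zero)             (suc (suc (suc zero))) → refl
  (suc (suc zero))       zero                   → refl
  (suc (suc zero))       (suc zero)             → refl
  (suc (suc zero))       (suc (suc zero))       → refl
  (suc (suc zero))       (suc (suc (suc zero))) → refl
  (suc (suc (suc zero))) zero                   → refl
  (suc (suc (suc zero))) (suc zero)             → refl
  (suc (suc (suc zero))) (suc (suc zero))       → refl
  (suc (suc (suc zero))) (suc (suc (suc zero))) → refl

graph₄ : Pattern → Graph 4
graph₄ p = record { adj = adj₄ p ; adj-sym = adj₄-sym p ; adj-irrefl = adj₄-irrefl p }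

vector₄ : ∀ {n} → Fin n → Fin n → Fin n → Fin n → Fin 4 → Fin n
vector₄ a b c d zero                   = a
vector₄ a b c d (suc zero)             = b
vector₄ a b c d (suc (suc zero))       = c
vector₄ a b c d (suc (suc (suc zero))) = d

Distinct₄ : ∀ {n} → Fin n → Fin n → Fin n → Fin n → Set
Distinct₄ a b c d = a ≢ b × a ≢ c × a ≢ d × b ≢ c × b ≢ d × c ≢ d

vector₄-injective : ∀ {n} {a b c d : Fin n} → Distinct₄ a b c d → ∀ {i j} → vector₄ a b c d i ≡ vector₄ a b c d j → i ≡ j
vector₄-injective (ab , ac , ad , bc , bd , cd) {i} {j} = go i j
  where
  go : ∀ i j → vector₄ _ _ _ _ i ≡ vector₄ _ _ _ _ j → i ≡ j
  go zero                   zero                   eq = refl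
  go zero                   (suc zero)             eq = ⊥-elim (ab eq)
  go zero                   (suc (suc zero))       eq = ⊥-elim (ac eq)
  go zero                   (suc (suc (suc zero))) eq = ⊥-elim (ad eq)
  go (suc zero)             zero                   eq = ⊥-elim (ab (sym eq))
  go (suc zero)             (suc zero)             eq = refl
  go (suc zero)             (suc (suc zero))       eq = ⊥-elim (bc eq)
  go (suc zero)             (suc (suc (suc zero))) eq = ⊥-elim (bd eq)
  go (suc (suc zero))       zero                   eq = ⊥-elim (ac (sym eq))
  go (suc (suc zero))       (suc zero)             eq = ⊥-elim (bc (sym eq))
  go (suc (suc zero))       (suc (suc zero))       eq = refl
  go (suc (suc zero))       (suc (suc (suc zero))) eq = ⊥-elim (cd eq)
  go (suc (suc (suc zero))) zero                   eq = ⊥-elim (ad (sym eq))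
  go (suc (suc (suc zero))) (suc zero)             eq = ⊥-elim (bd (sym eq))
  go (suc (suc (suc zero))) (suc (suc zero))       eq = ⊥-elim (cd (sym eq))
  go (suc (suc (suc zero))) (suc (suc (suc zero))) eq = refl

adjacency : ∀ {n} → Graph n → Fin n → Fin n → Fin n → Fin n → Pattern
adjacency G a b c d = patternOf λ i j → adj G (vector₄ a b c d i) (vector₄ a b c d j)

induced₄ : ∀ {n} (G : Graph n) {p a b c d} → Distinct₄ a b c d → adjacency G a b c d ≡ p → InducedSub (graph₄ p) G
induced₄ G {a = a} {b} {c} {d} distinct refl = vector₄ a b c d , vector₄-injective distinct ,
  λ i j → sym (adj₄-patternOf (λ i j → adj G (vector₄ a b c d i) (vector₄ a b c d j))
                 (λ i j → adj-sym G _ _) (λ i → adj-irrefl G _) i j)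

induced-trans : ∀ {k m n} {A : Graph k} {B : Graph m} {C : Graph n} → InducedSub A B → InducedSub B C → InducedSub A C
induced-trans (σ , σ-inj , σ-adj) (τ , τ-inj , τ-adj) =
  τ ∘ σ , σ-inj ∘ τ-inj , λ i j → trans (τ-adj (σ i) (σ j)) (σ-adj i j)

HasTriple : Pattern → Set
HasTriple p = (e₀₁ p ∨ e₀₂ p ∨ e₁₂ p ≡ false) ⊎ (e₀₁ p ∨ e₀₃ p ∨ e₁₃ p ≡ false) ⊎
              (e₀₂ p ∨ e₀₃ p ∨ e₂₃ p ≡ false) ⊎ (e₁₂ p ∨ e₁₃ p ∨ e₂₃ p ≡ false)

_≟ₚ_ : (p q : Pattern) → Dec (p ≡ q)
pattern₄ a b c d e f ≟ₚ pattern₄ a′ b′ c′ d′ e′ f′ = map′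
  (λ { (refl , refl , refl , refl , refl , refl) → refl }) (λ { refl → refl , refl , refl , refl , refl , refl })
  (a Bool.≟ a′ ×-dec b Bool.≟ b′ ×-dec c Bool.≟ c′ ×-dec d Bool.≟ d′ ×-dec e Bool.≟ e′ ×-dec f Bool.≟ f′)

Shaped : Pattern → Set
Shaped p = ∃ λ s → ∃ λ a → ∃ λ b → ∃ λ c → ∃ λ d → adjacency (graph₄ (shape s)) a b c d ≡ p × Distinct₄ a b c d

-- abstract, so that the exhaustive search is never unfolded on open terms
abstract
  classification : ∀ a b c d e f → let p = pattern₄ a b c d e f in HasTriple p ⊎ Shaped p
  classification = decided (all-Bool? λ a → all-Bool? λ b → all-Bool? λ c → all-Bool? λ d → all-Bool? λ e → all-Bool? λ f →
                     has-triple? (pattern₄ a b c d e f) ⊎-dec shaped? (pattern₄ a b c d e f))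
    where
    has-triple? : ∀ p → Dec (HasTriple p)
    has-triple? p = (_ Bool.≟ _) ⊎-dec (_ Bool.≟ _) ⊎-dec (_ Bool.≟ _) ⊎-dec (_ Bool.≟ _)

    shaped? : ∀ p → Dec (Shaped p)
    shaped? p = any? λ s → any? λ a → any? λ b → any? λ c → any? λ d → (_ ≟ₚ p) ×-dec
      (¬? (a ≟ b) ×-dec ¬? (a ≟ c) ×-dec ¬? (a ≟ d) ×-dec ¬? (b ≟ c) ×-dec ¬? (b ≟ d) ×-dec ¬? (c ≟ d))

∨-false : ∀ {a b c} → a ∨ b ∨ c ≡ false → a ≡ false × b ≡ false × c ≡ false
∨-false {false} {false} {false} _ = refl , refl , refl

shape-of : (H : Graph 4) → TripleFree H → ∃ λ s → InducedSub H (graph₄ (shape s))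
shape-of H free with classification (adj H v₀ v₁) (adj H v₀ v₂) (adj H v₀ v₃) (adj H v₁ v₂) (adj H v₁ v₃) (adj H v₂ v₃)
... | inj₁ (inj₁ t)               = let p , q , r = ∨-false t in ⊥-elim (free {v₀} {v₁} {v₂} (λ ()) (λ ()) (λ ()) p q r)
... | inj₁ (inj₂ (inj₁ t))        = let p , q , r = ∨-false t in ⊥-elim (free {v₀} {v₁} {v₃} (λ ()) (λ ()) (λ ()) p q r)
... | inj₁ (inj₂ (inj₂ (inj₁ t))) = let p , q , r = ∨-false t in ⊥-elim (free {v₀} {v₂} {v₃} (λ ()) (λ ()) (λ ()) p q r)
... | inj₁ (inj₂ (inj₂ (inj₂ t))) = let p , q , r = ∨-false t in ⊥-elim (free {v₁} {v₂} {v₃} (λ ()) (λ ()) (λ ()) p q r)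
... | inj₂ (s , a , b , c , d , eq , distinct) with induced₄ (graph₄ (shape s)) distinct eq
...   | τ , τ-inj , τ-adj = s , τ , τ-inj ,
        λ i j → trans (τ-adj i j) (adj₄-patternOf (adj H) (adj-sym H) (adj-irrefl H) i j)

-- Pads `H` to four vertices. A vertex adjacent to all others belongs to no independent pair, so the
-- bound on independent sets is kept, and a graph without induced `H` contains no induced cone over
-- `H`.
cone : ∀ {m} → Graph m → Graph (suc m)
cone H = record { adj = adj⁺ ; adj-sym = sym⁺ ; adj-irrefl = irrefl⁺ }
  where
  adj⁺ : Fin _ → Fin _ → Bool
  adj⁺ zero    zero    = false
  adj⁺ zero    (suc j) = true
  adj⁺ (suc i) zero    = true
  adj⁺ (suc i) (suc j) = adj H i j

  sym⁺ : ∀ i j → adj⁺ i j ≡ adj⁺ j i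
  sym⁺ zero    zero    = refl
  sym⁺ zero    (suc j) = refl
  sym⁺ (suc i) zero    = refl
  sym⁺ (suc i) (suc j) = adj-sym H i j

  irrefl⁺ : ∀ i → adj⁺ i i ≡ false
  irrefl⁺ zero    = refl
  irrefl⁺ (suc i) = adj-irrefl H i

cone-triple-free : ∀ {m} {H : Graph m} → TripleFree H → TripleFree (cone H)
cone-triple-free free {zero}  {zero}          ij _  _  _  _  _  = ij refl
cone-triple-free free {suc i} {zero}          _  _  _  () _  _
cone-triple-free free {suc i} {suc j} {suc k} ij ik jk ¬ij ¬ik ¬jk =
  free (ij ∘ cong suc) (ik ∘ cong suc) (jk ∘ cong suc) ¬ij ¬ik ¬jk

base-induced : ∀ {m} (H : Graph m) → InducedSub H (cone H)
base-induced H = suc , suc-injective , λ _ _ → refl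

small-shape : ∀ k {m} → k + m ≡ 4 → (H : Graph m) → TripleFree H → ∃ λ s → InducedSub H (graph₄ (shape s))
small-shape zero    refl H free = shape-of H free
small-shape (suc k) {m} eq H free =
  let s , sub = small-shape k (trans (+-suc k m) eq) (cone H) (cone-triple-free {H = H} free)
  in s , induced-trans {A = H} {B = cone H} {C = graph₄ (shape s)} (base-induced H) sub

-- From an excluded graph on four vertices to the immersion

module _ {n : ℕ} (G : Graph n) (α : α≤ G 2) where
  open Independence2 G α
  open Reduction G α
  open Patterns G α
  open Blowup G α

  private
    -- Adjacency in G expressed through `co`, the form in which the patterns deliver their data. As
    -- `v ∉ co u` also holds for u ≡ v, an edge of G has to ask for distinctness.
    Related : Bool → V → V → Set
    Related true  u v = u ≢ v × v ∉ co u
    Related false u v = v ∈ co u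

    related-≢ : ∀ b {u v} → Related b u v → u ≢ v
    related-≢ true  (u≢v , _) = u≢v
    related-≢ false uv        = co⇒≢ uv

    related-adj : ∀ b {u v} → Related b u v → adj G u v ≡ b
    related-adj true  (u≢v , ¬uv) = ¬co⇒Adj u≢v ¬uv
    related-adj false uv          = co⇒¬adj uv

    separated : ∀ {u v w} → w ∈ co u → w ∉ co v → u ≢ v
    separated {v = v} uw ¬vw refl = ∈-∉ {p = co v} uw ¬vw

  induced-shape : ∀ s (let p = shape s) {a b c d} →
    Related (e₀₁ p) a b → Related (e₀₂ p) a c → Related (e₀₃ p) a d →
    Related (e₁₂ p) b c → Related (e₁₃ p) b d → Related (e₂₃ p) c d → InducedSub (graph₄ p) G
  induced-shape s ab ac ad bc bd cd = induced₄ G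
    (related-≢ _ ab , related-≢ _ ac , related-≢ _ ad , related-≢ _ bc , related-≢ _ bd , related-≢ _ cd)
    (pattern-≡ (related-adj _ ab) (related-adj _ ac) (related-adj _ ad) (related-adj _ bc) (related-adj _ bd) (related-adj _ cd))
    where
    pattern-≡ : ∀ {a a′ b b′ c c′ d d′ e e′ f f′} → a ≡ a′ → b ≡ b′ → c ≡ c′ → d ≡ d′ → e ≡ e′ → f ≡ f′ →
                pattern₄ a b c d e f ≡ pattern₄ a′ b′ c′ d′ e′ f′
    pattern-≡ refl refl refl refl refl refl = refl

  shape-free-half : ∀ s → Free (graph₄ (shape s)) G → Half full
  shape-free-half s@zero free = 4K₁-half (λ pq pr ps qr qs rs ¬pq ¬pr ¬ps ¬qr ¬qs ¬rs → free (induced-shape s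
    (pq , ¬pq) (pr , ¬pr) (ps , ¬ps) (qr , ¬qr) (qs , ¬qs) (rs , ¬rs))) full
  shape-free-half s@(suc zero) free = edge+2K₁-half (λ uv x≢a xa xu xv au av → free (induced-shape s
    uv (separated uv xv , ¬co-sym xu) (separated uv av , ¬co-sym au)
    (separated (co-sym uv) xu , ¬co-sym xv) (separated (co-sym uv) au , ¬co-sym av) (x≢a , xa))) full
  shape-free-half s@(suc (suc zero)) free = 2K₂-half λ pq rs pr ps qr qs → free (induced-shape s
    pq (≢-sym (separated rs ps) , pr) (≢-sym (separated (co-sym rs) pr) , ps)
    (≢-sym (separated rs qs) , qr) (≢-sym (separated (co-sym rs) qr) , qs) rs)
  shape-free-half s@(suc (suc (suc zero))) free = P₃+K₁-half (λ pq qr p≢r sp sq sr → free (induced-shape s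
    pq (p≢r , co-triangle-free pq qr) (separated pq sq , ¬co-sym sp)
    qr (separated (co-sym pq) sp , ¬co-sym sq) (separated (co-sym qr) sq , ¬co-sym sr))) full
  shape-free-half s@(suc (suc (suc (suc zero)))) free = P₄-half (λ pq qr rs ps → free (induced-shape s
    pq (≢-sym (separated rs ps) , co-triangle-free pq qr) (separated pq (co-triangle-free (co-sym rs) (co-sym qr)) , ps)
    qr (separated (co-sym pq) (¬co-sym ps) , co-triangle-free qr rs) rs)) full
  shape-free-half s@(suc (suc (suc (suc (suc zero))))) free = star-half (λ cp cq cr p≢q p≢r q≢r → free (induced-shape s
    cp cq cr (p≢q , neighbourhood-clique cp cq) (p≢r , neighbourhood-clique cp cr) (q≢r , neighbourhood-clique cq cr))) full
  shape-free-half s@(suc (suc (suc (suc (suc (suc zero)))))) free = square-half (λ pq qr rs ps p≢r q≢s → free (induced-shape s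
    pq (p≢r , co-triangle-free pq qr) ps qr (q≢s , co-triangle-free qr rs) rs)) full

  #-full : ∀ k → # {k} (λ _ → true) ≡ k
  #-full zero    = refl
  #-full (suc k) = cong suc (#-full k)

  half-immersion : Half full → Immersion (complete ⌈ n /2⌉) G
  half-immersion (S , I , n≤) with choose S ⌈ n /2⌉ half≤
    where
    half≤ : ⌈ n /2⌉ ≤ # S
    half≤ = ≤-trans (⌈n/2⌉-mono (subst (_≤ # S + # S) (#-full n) n≤)) (≤-reflexive (sym (n≡⌈n+n/2⌉ (# S))))
  ... | φ , φ∈S , distinct =
    φ , (λ {i} {j} → injective {i} {j})
      , (λ u v u<v _ → path (φ∈S u) (φ∈S v) (distinct (<⇒≢ u<v)))
      , (λ u v u′ v′ u<v _ u′<v′ _ other a b uses →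
           (λ uses′ → apart u<v u′<v′ other (disjoint _ _ _ _ _ _ (inj₁ uses) (inj₁ uses′)))
         , (λ uses′ → apart u<v u′<v′ other (disjoint _ _ _ _ _ _ (inj₁ uses) (inj₂ uses′))))
      , (λ u v u<v _ → All.map (λ { (_ , w∉S) z refl → ∈-∉ {p = S} (φ∈S z) w∉S })
                               (interior∈ (φ∈S u) (φ∈S v) (distinct (<⇒≢ u<v))))
    where
    open Immersed I

    injective : ∀ {i j} → φ i ≡ φ j → i ≡ j
    injective {i} {j} eq = decidable-stable (i ≟ j) λ i≢j → distinct i≢j eq

    -- A shared edge identifies the two pairs only up to order; the swapped case would give both u <
    -- v and v < u.
    apart : ∀ {u v u′ v′} → u Fin.< v → u′ Fin.< v′ → ¬ (u ≡ u′ × v ≡ v′) →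
            ¬ ((φ u ≡ φ u′ × φ v ≡ φ v′) ⊎ (φ u ≡ φ v′ × φ v ≡ φ u′))
    apart _ _ other (inj₁ (eq , eq′)) = other (injective eq , injective eq′)
    apart u<v u′<v′ _ (inj₂ (eq , eq′)) with injective eq | injective eq′
    ... | refl | refl = <-asym u<v u′<v′

theorem1p4 : ∀ {n m} (G : Graph n) (H : Graph m) →
    α≤ G 2 → α≤ H 2 → m ≤ 4 → Free H G →
    Immersion (complete ⌈ n /2⌉) G
theorem1p4 {m = m} G H αG αH m≤4 free =
  let s , H⊆s = small-shape _ (m∸n+n≡m m≤4) H (α≤2⇒triple-free {H = H} αH)
  in half-immersion G αG (shape-free-half G αG s λ s⊆G →
       free (induced-trans {A = H} {B = graph₄ (shape s)} {C = G} H⊆s s⊆G))
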